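{- Let $n\ge 2$ and let $k,\ell\ge 0$ be integers. Then $$\mathrm{Dist}_n(k,\ell)=\sum_{\pi\in\Pi_k}\mathrm{IP}_\pi(\ell),$$ where $\mathrm{Dist}_n(k,\ell)$ is the coefficient of $q^k t^\ell$ in the two-variable distance enumerator $D_{\mathcal S_n}(q,t)$ of the Shi arrangement, $\Pi_k$ is the set of permutations of $\{1,\dots,n\}$ with exactly $k$ non-inversions, and $\mathrm{IP}_\pi(\ell)$ is the number of order ideals with exactly $\binom n2-k-\ell$ elements in the inversion poset $\mathrm{IP}_\pi$ of $\pi$.
   Context: The Shi arrangement $\mathcal S_n$ in $\mathbb R^n$ consists of the hyperplanes $x_i-x_j=0$ and $x_i-x_j=1$ for $1\le i<j\le n$. Its regions are the connected components of the complement in $\mathbb R^n$ of the union of the hyperplanes; $\mathcal R(\mathcal S_n)$ is the set of regions. The base region $B$ is the region $x_1>x_2>\cdots>x_n>x_1-1$. For a region $R$, let $a(R)$ be the number of hyperplanes of the form $x_i-x_j=0$ ($i<j$) separating $R$ from $B$, and $b(R)$ the number of hyperplanes of the form $x_i-x_j=1$ ($i<j$) separating $R$ from $B$. Define $D_{\mathcal S_n}(q,t)=\sum_{R\in\mathcal R(\mathcal S_n)}q^{a(R)}t^{b(R)}$. A permutation $\pi=(\pi_1,\dots,\pi_n)$ of $\{1,\dots,n\}$ is written in one-line notation. An inversion of $\pi$ is a pair $(\pi_i,\pi_j)$ with $i<j$ and $\pi_i>\pi_j$; a non-inversion is a pair $(\pi_i,\pi_j)$ with $i<j$ and $\pi_i<\pi_j$.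 The inversion poset $\mathrm{IP}_\pi$ has as elements the inversions of $\pi$, ordered by containment of positions: for inversions $g=(\pi_i,\pi_j)$ with $i<j$ and $h=(\pi_a,\pi_b)$ with $a<b$, $g\le h$ iff $a\le i<j\le b$. An (order) ideal is a downward closed subset; the number of ideals with a negative number of elements is $0$. -}

module Defs where

open import Data.Bool.Base using (if_then_else_)
open import Data.Empty using (⊥)
open import Data.Fin.Base as Fin using (Fin; toℕ)
import Data.Fin.Properties as Fin
open import Data.Integer.Base as ℤ using (ℤ; +_)
import Data.Integer.Properties as ℤ
open import Data.List.Base
  using (List; []; _∷_; _++_; map; foldr; filter; length; allFin; cartesianProduct; cartesianProductWith)
import Data.List.Membership.DecPropositional as DecMembership
open import Data.List.Membership.Propositional using (_∈_)
open import Data.List.Relation.Unary.All as All using (All)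
import Data.List.Relation.Unary.Enumerates.Setoid as Enumerates
open import Data.List.Relation.Unary.Unique.Propositional using (Unique)
import Data.List.Relation.Unary.Unique.Setoid as SetoidUnique
open import Data.Nat.Base as ℕ using (ℕ; zero; suc)
import Data.Nat.Properties as ℕ
open import Data.Nat.Combinatorics using () renaming (_C_ to _choose_)
open import Data.Product.Base using (Σ; Σ-syntax; ∃-syntax; _×_; _,_; proj₁; proj₂)
open import Data.Product.Properties using (≡-dec)
open import Data.Rational.Base as ℚ using (ℚ; 0ℚ; 1ℚ; ½)
import Data.Rational.Properties as ℚ
open import Data.Rational.Solver using (module +-*-Solver)
open import Data.Sum.Base as Sum using (_⊎_; inj₁; inj₂)
open import Data.Vec.Base as Vec using (Vec; lookup)
open import Data.Vec.Relation.Unary.AllPairs using (allPairs?)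
open import Function.Base using (_∘_)
open import Function.Bundles using (_⇔_)
open import Level using (Level; 0ℓ)
open import Relation.Binary.Bundles using (Setoid)
open import Relation.Binary.PropositionalEquality using (_≡_; refl; sym; trans; cong; subst)
open import Relation.Nullary.Decidable using (Dec; ¬?; _×-dec_; _→-dec_; does)
open import Relation.Nullary.Negation using (¬_)
open import Relation.Unary using (Pred; Decidable; _⊆_; _∪_)

private
  variable
    ℓ₁ ℓ₂ : Level
    n : ℕ

------------------------------------------------------------------------
-- Real numbers: Cauchy sequences of rationals.
--
-- No equality of reals appears below: every notion used is expressed by the
-- strict order, which is invariant under adding null sequences.

IsCauchy : (ℕ → ℚ) → Set
IsCauchy x = ∀ ε → 0ℚ ℚ.< ε →
  ∃[ N ] (∀ i j → N ℕ.≤ i → N ℕ.≤ j → ℚ.∣ x i ℚ.- x j ∣ ℚ.< ε)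

record ℝ : Set where
  constructor mkℝ
  field
    seq    : ℕ → ℚ
    cauchy : IsCauchy seq

open ℝ public

infix 4 _<_ _#_

_<_ : ℝ → ℝ → Set
x < y = ∃[ ε ] (0ℚ ℚ.< ε × ∃[ N ] (∀ i → N ℕ.≤ i → seq x i ℚ.+ ε ℚ.< seq y i))

-- Apartness, the constructive form of "x ≠ y".
_#_ : ℝ → ℝ → Set
x # y = x < y ⊎ y < x

fromℚ : ℚ → ℝ
fromℚ p = mkℝ (λ _ → p) λ ε ε>0 →
  0 , λ _ _ _ _ → subst (λ z → ℚ.∣ z ∣ ℚ.< ε) (sym (ℚ.+-inverseʳ p)) ε>0

0ℝ 1ℝ : ℝ
0ℝ = fromℚ 0ℚ
1ℝ = fromℚ 1ℚ

infixl 6 _-_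

_-_ : ℝ → ℝ → ℝ
seq (x - y) i = seq x i ℚ.- seq y i
cauchy (x - y) ε ε>0
  with cauchy x (½ ℚ.* ε) ε/2>0 | cauchy y (½ ℚ.* ε) ε/2>0
  where
  ε/2>0 : 0ℚ ℚ.< ½ ℚ.* ε
  ε/2>0 = subst (ℚ._< ½ ℚ.* ε) (ℚ.*-zeroʳ ½) (ℚ.*-monoʳ-<-pos ½ ε>0)
... | M , x-close | N , y-close = M ℕ.⊔ N , close
  where
  open +-*-Solver

  regroup : ∀ a b c d → (a ℚ.- b) ℚ.- (c ℚ.- d) ≡ (a ℚ.- c) ℚ.- (b ℚ.- d)
  regroup = solve 4 (λ a b c d → (a :- b) :- (c :- d) := (a :- c) :- (b :- d)) refl

  halves : ½ ℚ.* ε ℚ.+ ½ ℚ.* ε ≡ ε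
  halves = trans (sym (ℚ.*-distribʳ-+ ε ½ ½)) (ℚ.*-identityˡ ε)

  close : ∀ i j → M ℕ.⊔ N ℕ.≤ i → M ℕ.⊔ N ℕ.≤ j →
          ℚ.∣ (seq x i ℚ.- seq y i) ℚ.- (seq x j ℚ.- seq y j) ∣ ℚ.< ε
  close i j i≥ j≥ = begin-strict
    ℚ.∣ (seq x i ℚ.- seq y i) ℚ.- (seq x j ℚ.- seq y j) ∣
      ≡⟨ cong ℚ.∣_∣ (regroup (seq x i) (seq y i) (seq x j) (seq y j)) ⟩
    ℚ.∣ (seq x i ℚ.- seq x j) ℚ.- (seq y i ℚ.- seq y j) ∣
      ≤⟨ ℚ.∣p-q∣≤∣p∣+∣q∣ (seq x i ℚ.- seq x j) (seq y i ℚ.- seq y j) ⟩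
    ℚ.∣ seq x i ℚ.- seq x j ∣ ℚ.+ ℚ.∣ seq y i ℚ.- seq y j ∣
      <⟨ ℚ.+-mono-< (x-close i j (ℕ.m⊔n≤o⇒m≤o M N i≥) (ℕ.m⊔n≤o⇒m≤o M N j≥))
                    (y-close i j (ℕ.m⊔n≤o⇒n≤o M N i≥) (ℕ.m⊔n≤o⇒n≤o M N j≥)) ⟩
    ½ ℚ.* ε ℚ.+ ½ ℚ.* ε
      ≡⟨ halves ⟩
    ε ∎
    where open ℚ.≤-Reasoning

------------------------------------------------------------------------
-- Connected components in ℝⁿ

Point : ℕ → Set
Point n = Fin n → ℝ

-- y lies in the open ball around x of radius ε, for the sup metric.
Near : ℚ → Point n → Point n → Set
Near ε x y = ∀ i → x i - y i < fromℚ ε × y i - x i < fromℚ ε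

-- C ∩ U is open in the subspace topology of C.
RelativelyOpen : Pred (Point n) 0ℓ → Pred (Point n) 0ℓ → Set
RelativelyOpen A U =
  ∀ x → A x → U x → ∃[ ε ] (0ℚ ℚ.< ε × (∀ y → A y → Near ε x y → U y))

-- No two disjoint relatively open sets cover A and both meet it.
Connected : Pred (Point n) 0ℓ → Set₁
Connected {n} A =
  (U V : Pred (Point n) 0ℓ) →
  RelativelyOpen A U → RelativelyOpen A V →
  (∀ z → A z → U z ⊎ V z) →
  (∀ z → A z → U z → ¬ V z) →
  ∀ x y → A x → U x → A y → ¬ V y

SameComponent : Pred (Point n) 0ℓ → Point n → Point n → Set₁
SameComponent {n} S x y =
  Σ[ A ∈ Pred (Point n) 0ℓ ] ((∀ z → A z → S z) × Connected A × A x × A y)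

module _ (S : Pred (Point n) 0ℓ) where

  sameComponent-refl : ∀ x → S x → SameComponent S x x
  sameComponent-refl x Sx =
    (_≡ x) , (λ { _ refl → Sx }) ,
    (λ { _ _ _ _ _ disjoint _ _ refl Ux refl → disjoint x refl Ux }) , refl , refl

  sameComponent-sym : ∀ x y → SameComponent S x y → SameComponent S y x
  sameComponent-sym _ _ (A , A⊆S , conn , Ax , Ay) = A , A⊆S , conn , Ay , Ax

  sameComponent-trans : ∀ x y z →
    SameComponent S x y → SameComponent S y z → SameComponent S x z
  sameComponent-trans x y z (A , A⊆S , connA , Ax , Ay) (B , B⊆S , connB , By , Bz) =
    A ∪ B , (λ w → Sum.[ A⊆S w , B⊆S w ]) , connA∪B , inj₁ Ax , inj₂ Bz
    where
    restrict : (D E U : Pred (Point n) 0ℓ) → (∀ w → D w → E w) →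
               RelativelyOpen E U → RelativelyOpen D U
    restrict D E U D⊆E openU w Dw Uw =
      let ε , ε>0 , ball = openU w (D⊆E w Dw) Uw
      in ε , ε>0 , λ v Dv → ball v (D⊆E v Dv)

    connA∪B : Connected (A ∪ B)
    connA∪B U V openU openV cover disjoint u v u∈ Uu v∈ Vv = by (cover y (inj₁ Ay)) u∈ v∈
      where
      inA : ∀ p q → A p → U p → A q → ¬ V q
      inA = connA U V (restrict A (A ∪ B) U (λ _ → inj₁) openU)
                      (restrict A (A ∪ B) V (λ _ → inj₁) openV)
                      (λ w → cover w ∘ inj₁) (λ w → disjoint w ∘ inj₁)

      inB : ∀ p q → B p → U p → B q → ¬ V q
      inB = connB U V (restrict B (A ∪ B) U (λ _ → inj₂) openU)
                      (restrict B (A ∪ B) V (λ _ → inj₂) openV)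
                      (λ w → cover w ∘ inj₂) (λ w → disjoint w ∘ inj₂)

      by : U y ⊎ V y → A u ⊎ B u → A v ⊎ B v → ⊥
      by (inj₁ Uy) _         (inj₁ Av) = inA y v Ay Uy Av Vv
      by (inj₁ Uy) _         (inj₂ Bv) = inB y v By Uy Bv Vv
      by (inj₂ Vy) (inj₁ Au) _         = inA u y Au Uu Ay Vy
      by (inj₂ Vy) (inj₂ Bu) _         = inB u y Bu Uu By Vy

------------------------------------------------------------------------
-- The Shi arrangement

-- The hyperplane x_i - x_j = c is given by c, i and j; these are its two open
-- half-spaces.
Above Below : ℝ → Fin n → Fin n → Pred (Point n) 0ℓ
Above c i j x = c < x i - x j
Below c i j x = x i - x j < c

ShiComplement : Pred (Point n) 0ℓ
ShiComplement x = ∀ i j → i Fin.< j → (x i - x j # 0ℝ) × (x i - x j # 1ℝ)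

-- A region is represented by any of its points.
Regions : ℕ → Setoid _ _
Regions n = record
  { Carrier       = Σ (Point n) ShiComplement
  ; _≈_           = λ x y → SameComponent ShiComplement (proj₁ x) (proj₁ y)
  ; isEquivalence = record
    { refl  = λ {x} → sameComponent-refl ShiComplement (proj₁ x) (proj₂ x)
    ; sym   = λ {x} {y} → sameComponent-sym ShiComplement (proj₁ x) (proj₁ y)
    ; trans = λ {x} {y} {z} →
        sameComponent-trans ShiComplement (proj₁ x) (proj₁ y) (proj₁ z)
    }
  }

Region : ℕ → Set
Region n = Setoid.Carrier (Regions n)

points : Region n → Pred (Point n) _
points R = SameComponent ShiComplement (proj₁ R)

-- x₁ > x₂ > ⋯ > xₙ > x₁ - 1
BaseRegion : Pred (Point n) 0ℓ
BaseRegion {n} x =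
  (∀ i j → toℕ j ≡ suc (toℕ i) → x j < x i) ×
  (∀ i j → toℕ i ≡ 0 → suc (toℕ j) ≡ n → x i - 1ℝ < x j)

Separates : ℝ → Fin n → Fin n → Pred (Point n) ℓ₁ → Pred (Point n) ℓ₂ → Set _
Separates c i j P Q =
  (P ⊆ Above c i j × Q ⊆ Below c i j) ⊎ (P ⊆ Below c i j × Q ⊆ Above c i j)

-- The pairs i < j for which x_i - x_j = c separates R from the base region.
SeparatingPair : ℝ → Region n → Pred (Fin n × Fin n) _
SeparatingPair c R (i , j) = i Fin.< j × Separates c i j (points R) BaseRegion

HasCardinality : {A : Set} → Pred A ℓ₁ → ℕ → Set _
HasCardinality {A = A} P m =
  Σ[ xs ∈ List A ] (Unique xs × (∀ x → x ∈ xs ⇔ P x) × length xs ≡ m)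

------------------------------------------------------------------------
-- The distance enumerator

-- An element of ℕ[q,t], as the function sending (k , ℓ) to its coefficient
-- of q^k t^ℓ.
Poly : Set
Poly = ℕ → ℕ → ℕ

q^_t^_ : ℕ → ℕ → Poly
(q^ a t^ b) k ℓ = if does ((k ℕ.≟ a) ×-dec (ℓ ℕ.≟ b)) then 1 else 0

∑ : List Poly → Poly
∑ = foldr (λ f g k ℓ → f k ℓ ℕ.+ g k ℓ) (λ _ _ → 0)

-- The list of all regions, without repetitions, and the two statistics on it.
-- All of this is determined by n up to the order of the list and the choice of
-- representatives.
record ShiRegions (n : ℕ) : Set₁ where
  field
    regions  : List (Region n)
    unique   : SetoidUnique.Unique (Regions n) regions
    complete : Enumerates.IsEnumeration (Regions n) regions
    a b      : Region n → ℕ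
    a-counts : ∀ R → HasCardinality (SeparatingPair 0ℝ R) (a R)
    b-counts : ∀ R → HasCardinality (SeparatingPair 1ℝ R) (b R)

  distanceEnumerator : Poly
  distanceEnumerator = ∑ (map (λ R → q^ a R t^ b R) regions)

Dist : ShiRegions n → ℕ → ℕ → ℕ
Dist 𝓡 k ℓ = ShiRegions.distanceEnumerator 𝓡 k ℓ

------------------------------------------------------------------------
-- Permutations in one-line notation

words : (m n : ℕ) → List (Vec (Fin m) n)
words m zero    = Vec.[] ∷ []
words m (suc n) = cartesianProductWith Vec._∷_ (allFin m) (words m n)

permutations : (n : ℕ) → List (Vec (Fin n) n)
permutations n = filter (allPairs? λ x y → ¬? (x Fin.≟ y)) (words n n)

-- (Non-)inversions are recorded by their pair of positions; since the entries
-- of π are distinct, this is the same as recording the pair of values.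
Inversion NonInversion : Vec (Fin n) n → Pred (Fin n × Fin n) 0ℓ
Inversion    π (i , j) = i Fin.< j × lookup π j Fin.< lookup π i
NonInversion π (i , j) = i Fin.< j × lookup π i Fin.< lookup π j

inversion? : (π : Vec (Fin n) n) → Decidable (Inversion π)
inversion? π (i , j) = (i Fin.<? j) ×-dec (lookup π j Fin.<? lookup π i)

nonInversion? : (π : Vec (Fin n) n) → Decidable (NonInversion π)
nonInversion? π (i , j) = (i Fin.<? j) ×-dec (lookup π i Fin.<? lookup π j)

pairs : (n : ℕ) → List (Fin n × Fin n)
pairs n = cartesianProduct (allFin n) (allFin n)

inversions nonInversions : Vec (Fin n) n → List (Fin n × Fin n)
inversions    π = filter (inversion? π) (pairs _)
nonInversions π = filter (nonInversion? π) (pairs _)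

Π[_] : (k : ℕ) {n : ℕ} → List (Vec (Fin n) n)
Π[ k ] {n} = filter (λ π → length (nonInversions π) ℕ.≟ k) (permutations n)

------------------------------------------------------------------------
-- The inversion poset and its ideals

infix 4 _≼_ _≼?_

_≼_ : Fin n × Fin n → Fin n × Fin n → Set
(i , j) ≼ (a , b) = a Fin.≤ i × j Fin.≤ b

_≼?_ : (g h : Fin n × Fin n) → Dec (g ≼ h)
(i , j) ≼? (a , b) = (a Fin.≤? i) ×-dec (j Fin.≤? b)

-- Each subset of the entries of a repetition-free list occurs exactly once.
subsets : {A : Set ℓ₁} → List A → List (List A)
subsets []       = [] ∷ []
subsets (x ∷ xs) = subsets xs ++ map (x ∷_) (subsets xs)

IsIdeal : Vec (Fin n) n → Pred (List (Fin n × Fin n)) 0ℓ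
IsIdeal π I = All (λ h → All (λ g → g ≼ h → g ∈ I) (inversions π)) I

isIdeal? : (π : Vec (Fin n) n) → Decidable (IsIdeal π)
isIdeal? π I =
  All.all? (λ h → All.all? (λ g → (g ≼? h) →-dec (g ∈? I)) (inversions π)) I
  where open DecMembership (≡-dec Fin._≟_ Fin._≟_) using (_∈?_)

ideals : Vec (Fin n) n → List (List (Fin n × Fin n))
ideals π = filter (isIdeal? π) (subsets (inversions π))

-- The size is an integer, so that no ideal is counted when it is negative.
#idealsOfSize : Vec (Fin n) n → ℤ → ℕ
#idealsOfSize π s = length (filter (λ I → + length I ℤ.≟ s) (ideals π))

IP : Vec (Fin n) n → ℕ → ℕ → ℕ
IP {n} π k ℓ = #idealsOfSize π (+ (n choose 2) ℤ.- + k ℤ.- + ℓ)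

{-# OPTIONS --safe #-}

-- Listing the coordinates of a point of the complement in increasing order
-- gives a permutation π.  For i < j, the hyperplane x_i - x_j = 0 separates the
-- point from the base region iff i precedes j in π, so a(R) is the number of
-- non-inversions of π; and x_i - x_j = 1 separates iff (j , i) is an inversion
-- whose coordinates differ by more than 1.  The remaining inversions form an
-- ideal I of the inversion poset, whence b(R) = C(n,2) - a(R) - |I|.  Conversely
-- every (π , I) comes from a region: extend I to the down-set it generates among
-- all pairs of positions and choose the coordinates from the largest one down.
-- Regions are determined by their side of each hyperplane because convex sets
-- are connected, which is proved by bisecting a segment.
module Submission where

open import Defs
open import Data.Bool.Base using (true; false)
open import Data.Empty using (⊥; ⊥-elim)
open import Data.Fin.Base as Fin using (Fin; zero; suc)
import Data.Fin.Properties as Fin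
open import Data.Integer.Base as ℤ using (+_)
import Data.Integer.Properties as ℤ
import Data.Integer.Solver as ℤSolver
open import Data.List.Base as List
  using (List; []; _∷_; _++_; map; filter; length; allFin; concat; sum)
import Data.List.Properties as List
import Data.List.Membership.DecPropositional as DecMembership
open import Data.List.Membership.Propositional using (_∈_; _∉_; find)
open import Data.List.Membership.Propositional.Properties
open import Data.List.Relation.Binary.Permutation.Propositional using (↭-sym; ↭⇒↭ₛ)
open import Data.List.Relation.Binary.Permutation.Propositional.Properties using (↭-length)
import Data.List.Relation.Binary.Permutation.Setoid.Properties as PermSetoid
open import Data.List.Relation.Unary.All as All using (All; []; _∷_)
import Data.List.Relation.Unary.All.Properties as All
open import Data.List.Relation.Unary.AllPairs as AllPairs using (AllPairs; []; _∷_)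
import Data.List.Relation.Unary.AllPairs.Properties as AllPairs
open import Data.List.Relation.Unary.Any as Any using (Any; here; there; index)
import Data.List.Relation.Unary.Any.Properties as Any
import Data.List.Relation.Unary.Sorted.TotalOrder.Properties as Sorted
open import Data.List.Relation.Unary.Unique.Propositional using (Unique)
import Data.List.Relation.Unary.Unique.Propositional.Properties as Unique
import Data.List.Relation.Unary.Unique.Setoid as SetoidUnique
import Data.List.Sort as Sort
open import Data.Nat.Base as ℕ using (ℕ; zero; suc; _≤_)
import Data.Nat.Properties as ℕ
open import Data.Nat.Combinatorics using (nC1≡n; nCk+nC[k+1]≡[n+1]C[k+1]) renaming (_C_ to _choose_)
open import Data.Product.Base using (∃-syntax; Σ-syntax; _×_; _,_; proj₁; proj₂; swap)
open import Data.Product.Properties using (≡-dec)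
open import Data.Rational.Base as ℚ using (ℚ; mkℚ; 0ℚ; 1ℚ; ½)
import Data.Rational.Properties as ℚ
open import Data.Rational.Solver using (module +-*-Solver)
import Data.Rational.Unnormalised.Base as ℚᵘ
import Data.Rational.Unnormalised.Properties as ℚᵘ
open import Data.Sum.Base as Sum using (_⊎_; inj₁; inj₂)
open import Data.Unit.Base using (⊤; tt)
open import Data.Vec.Base as Vec using (Vec; lookup)
import Data.Vec.Properties as Vec
import Data.Vec.Relation.Unary.All as VecAll
import Data.Vec.Relation.Unary.All.Properties as VecAll
import Data.Vec.Relation.Unary.AllPairs as VecAllPairs
open import Function.Base using (_∘_)
open import Function.Bundles using (mk⇔; Equivalence)
open import Function.Definitions using (Injective)
open import Level using (Level; 0ℓ)
open import Relation.Binary.Bundles using (DecTotalOrder; StrictTotalOrder)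
open import Relation.Binary.Definitions using (Tri; tri<; tri≈; tri>)
open import Relation.Binary.PropositionalEquality
  using (_≡_; _≢_; refl; sym; trans; cong; cong₂; subst; subst₂; setoid; isEquivalence;
         module ≡-Reasoning)
import Relation.Binary.Properties.StrictTotalOrder as StrictTotalOrderProperties
open import Relation.Nullary.Decidable using (Dec; yes; no; ¬?; _×-dec_; does)
open import Relation.Nullary.Negation using (¬_)
open import Relation.Unary using (Pred; Decidable)

-- The order on Cauchy reals is not decidable, so the finite combinatorics has to draw every
-- decision from the data of a point: membership in `ShiComplement` says on which side of each
-- hyperplane the point lies. This is what allows coordinates to be sorted, ideals to be filtered
-- and separating pairs to be counted. Connectedness works in the same spirit: the cover by `U` and
-- `V` is an explicit alternative at each point, which the bisection consults at rational parameters
-- and finally at the limit.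
--
-- The equality is claimed for every enumeration `𝓡`, whose order and representatives are arbitrary
-- and whose regions are identified only up to lying in one component. The lists are therefore not
-- compared through a function but through the relation `Encodes` between pairs `(π , I)` and
-- points: lengths agree when every entry has a partner in the other list and no two entries of one
-- list share a partner. The same relation, taken over all codes, produces an enumeration, so that
-- the claim is not vacuous.

private
  variable
    ℓ p : Level
    A B : Set
    n : ℕ

-- Inequalities between rational numbers

open +-*-Solver

private
  a+[c-a]≡c : ∀ a c → a ℚ.+ (c ℚ.- a) ≡ c
  a+[c-a]≡c = solve 2 (λ a c → a :+ (c :- a) := c) refl

  shift : ∀ a b c d → d ℚ.- c ≡ b ℚ.- a → b ℚ.+ (c ℚ.- a) ≡ d
  shift a b c d eq = trans (solve 3 (λ a b c → b :+ (c :- a) := (b :- a) :+ c) refl a b c)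
    (trans (cong (ℚ._+ c) (sym eq)) (solve 2 (λ d c → (d :- c) :+ c := d) refl d c))

-- Linear inequalities are reduced to a ring identity between the two differences.
<-by : ∀ {a b c d} → a ℚ.< b → d ℚ.- c ≡ b ℚ.- a → c ℚ.< d
<-by {a} {b} {c} {d} a<b eq =
  subst₂ ℚ._<_ (a+[c-a]≡c a c) (shift a b c d eq) (ℚ.+-monoˡ-< (c ℚ.- a) a<b)

≤-by : ∀ {a b c d} → a ℚ.≤ b → d ℚ.- c ≡ b ℚ.- a → c ℚ.≤ d
≤-by {a} {b} {c} {d} a≤b eq =
  subst₂ ℚ._≤_ (a+[c-a]≡c a c) (shift a b c d eq) (ℚ.+-monoˡ-≤ (c ℚ.- a) a≤b)

p≤∣p∣ : ∀ p → p ℚ.≤ ℚ.∣ p ∣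
p≤∣p∣ p with ℚ.≤-total 0ℚ p
... | inj₁ 0≤p = ℚ.≤-reflexive (sym (ℚ.0≤p⇒∣p∣≡p 0≤p))
... | inj₂ p≤0 = ℚ.≤-trans p≤0 (ℚ.0≤∣p∣ p)

-p≤∣p∣ : ∀ p → ℚ.- p ℚ.≤ ℚ.∣ p ∣
-p≤∣p∣ p = subst (ℚ.- p ℚ.≤_) (ℚ.∣-p∣≡∣p∣ p) (p≤∣p∣ (ℚ.- p))

∣p∣≤ : ∀ {p b} → p ℚ.≤ b → ℚ.- p ℚ.≤ b → ℚ.∣ p ∣ ℚ.≤ b
∣p∣≤ {p} p≤b -p≤b with ℚ.∣p∣≡p∨∣p∣≡-p p
... | inj₁ eq = subst (ℚ._≤ _) (sym eq) p≤b
... | inj₂ eq = subst (ℚ._≤ _) (sym eq) -p≤b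

*-mono-≤-nonNeg : ∀ {p q r s} → 0ℚ ℚ.≤ q → 0ℚ ℚ.≤ r →
                  p ℚ.≤ q → r ℚ.≤ s → p ℚ.* r ℚ.≤ q ℚ.* s
*-mono-≤-nonNeg {p} {q} {r} {s} 0≤q 0≤r p≤q r≤s = ℚ.≤-trans
  (ℚ.*-monoʳ-≤-nonNeg r {{ℚ.nonNegative 0≤r}} p≤q)
  (ℚ.*-monoˡ-≤-nonNeg q {{ℚ.nonNegative 0≤q}} r≤s)

½*-pos : ∀ {ε} → 0ℚ ℚ.< ε → 0ℚ ℚ.< ½ ℚ.* ε
½*-pos {ε} ε>0 = subst (ℚ._< ½ ℚ.* ε) (ℚ.*-zeroʳ ½) (ℚ.*-monoʳ-<-pos ½ ε>0)

½+½ : ∀ ε → ½ ℚ.* ε ℚ.+ ½ ℚ.* ε ≡ ε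
½+½ = solve 1 (λ ε → con ½ :* ε :+ con ½ :* ε := ε) refl

½*-≤ : ∀ {ε} → 0ℚ ℚ.< ε → ½ ℚ.* ε ℚ.< ε
½*-≤ {ε} ε>0 = <-by (½*-pos ε>0)
  (solve 1 (λ ε → ε :- con ½ :* ε := con ½ :* ε :- con 0ℚ) refl ε)

quotient : ∀ {M ε} → 0ℚ ℚ.< M → 0ℚ ℚ.< ε → ∃[ δ ] (0ℚ ℚ.< δ × M ℚ.* δ ≡ ε)
quotient {M} {ε} M>0 ε>0 = (ℚ.1/ M) ℚ.* ε , pos ,
  trans (sym (ℚ.*-assoc M (ℚ.1/ M) ε))
    (trans (cong (ℚ._* ε) (ℚ.*-inverseʳ M)) (ℚ.*-identityˡ ε))
  where
  instance
    M-pos = ℚ.positive M>0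
    M-nonZero = ℚ.pos⇒nonZero M
  pos : 0ℚ ℚ.< (ℚ.1/ M) ℚ.* ε
  pos = ℚ.positive⁻¹ _ {{ℚ.pos*pos⇒pos (ℚ.1/ M) {{ℚ.1/pos⇒pos M}} ε {{ℚ.positive ε>0}}}}

-- Negative powers of two and the Archimedean property

2^- : ℕ → ℚ
2^- zero    = 1ℚ
2^- (suc k) = ½ ℚ.* 2^- k

2^->0 : ∀ k → 0ℚ ℚ.< 2^- k
2^->0 zero    = ℚ.positive⁻¹ 1ℚ
2^->0 (suc k) = ½*-pos (2^->0 k)

2^-anti : ∀ {i j} → i ℕ.≤ j → 2^- j ℚ.≤ 2^- i
2^-anti {i} i≤j = go (ℕ.≤⇒≤′ i≤j)
  where
  go : ∀ {j} → i ℕ.≤′ j → 2^- j ℚ.≤ 2^- i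
  go (ℕ.≤′-reflexive refl) = ℚ.≤-refl
  go (ℕ.≤′-step {k} p)     = ℚ.≤-trans (ℚ.<⇒≤ (½*-≤ (2^->0 k))) (go p)

ι : ℕ → ℚ
ι zero    = 0ℚ
ι (suc k) = 1ℚ ℚ.+ ι k

-- This is `k ≤ 2^k` in divided form. In the inductive step, `(1 + k) / 2^(k+1)` is the average of
-- `1 / 2^k` and `k / 2^k`, and both are at most 1.
ι*2^-≤1 : ∀ k → ι k ℚ.* 2^- k ℚ.≤ 1ℚ
ι*2^-≤1 zero    = ℚ.<⇒≤ (2^->0 0)
ι*2^-≤1 (suc k) = ≤-by (ℚ.+-mono-≤ (½-mono (2^-anti {0} {k} ℕ.z≤n)) (½-mono (ι*2^-≤1 k)))
  (solve 2 (λ i h → con 1ℚ :- (con 1ℚ :+ i) :* (con ½ :* h) :=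
    (con ½ :* con 1ℚ :+ con ½ :* con 1ℚ) :- (con ½ :* h :+ con ½ :* (i :* h))) refl (ι k) (2^- k))
  where
  ½-mono : ∀ {p q} → p ℚ.≤ q → ½ ℚ.* p ℚ.≤ ½ ℚ.* q
  ½-mono = ℚ.*-monoˡ-≤-nonNeg ½

toℚᵘ-ι : ∀ k → ℚ.toℚᵘ (ι k) ℚᵘ.≃ ℚᵘ.mkℚᵘ (+ k) 0
toℚᵘ-ι zero    = ℚᵘ.≃-refl
toℚᵘ-ι (suc k) = ℚᵘ.≃-trans (ℚ.toℚᵘ-homo-+ 1ℚ (ι k))
  (ℚᵘ.≃-trans (ℚᵘ.+-congʳ (ℚ.toℚᵘ 1ℚ) (toℚᵘ-ι k))
    (ℚᵘ.*≡* (cong (ℤ._* + 1) (cong (ℤ._+_ (+ 1)) (ℤ.*-identityʳ (+ k))))))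

-- The absolute value of the numerator serves as the bound, because the denominator is at least 1.
archimedean : ∀ p → ∃[ k ] p ℚ.≤ ι k
archimedean p@(mkℚ m d _) = ℤ.∣ m ∣ , ℚ.toℚᵘ-cancel-≤
  (ℚᵘ.≤-respʳ-≃ (ℚᵘ.≃-sym (toℚᵘ-ι ℤ.∣ m ∣)) (ℚᵘ.*≤* (bound m)))
  where
  bound : ∀ m → m ℤ.* + 1 ℤ.≤ + ℤ.∣ m ∣ ℤ.* + suc d
  bound m = ℤ.≤-trans (ℤ.≤-reflexive (ℤ.*-identityʳ m)) (ℤ.≤-trans (m≤∣m∣ m)
    (subst (+ ℤ.∣ m ∣ ℤ.≤_) (ℤ.pos-* ℤ.∣ m ∣ (suc d)) (ℤ.+≤+ (ℕ.m≤m*n ℤ.∣ m ∣ (suc d)))))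
    where
    m≤∣m∣ : ∀ m → m ℤ.≤ + ℤ.∣ m ∣
    m≤∣m∣ (+ _)    = ℤ.≤-refl
    m≤∣m∣ (ℤ.-[1+ _ ]) = ℤ.-≤+

2^-small : ∀ ε → 0ℚ ℚ.< ε → ∃[ k ] 2^- k ℚ.≤ ε
2^-small ε ε>0 = k , (begin
  2^- k                        ≡⟨ ℚ.*-identityˡ (2^- k) ⟨
  1ℚ ℚ.* 2^- k                 ≡⟨ cong (ℚ._* 2^- k) (proj₂ (proj₂ inv)) ⟨
  (ε ℚ.* δ) ℚ.* 2^- k          ≤⟨ ℚ.*-monoʳ-≤-nonNeg (2^- k) {{ℚ.nonNegative (ℚ.<⇒≤ (2^->0 k))}}
                                    (ℚ.*-monoˡ-≤-nonNeg ε {{ℚ.nonNegative (ℚ.<⇒≤ ε>0)}} (proj₂ arch)) ⟩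
  (ε ℚ.* ι k) ℚ.* 2^- k        ≡⟨ ℚ.*-assoc ε (ι k) (2^- k) ⟩
  ε ℚ.* (ι k ℚ.* 2^- k)        ≤⟨ ℚ.*-monoˡ-≤-nonNeg ε {{ℚ.nonNegative (ℚ.<⇒≤ ε>0)}} (ι*2^-≤1 k) ⟩
  ε ℚ.* 1ℚ                     ≡⟨ ℚ.*-identityʳ ε ⟩
  ε                            ∎)
  where
  open ℚ.≤-Reasoning
  -- `2^- 0` is `1ℚ`, so `δ` is the reciprocal of `ε`, and `k` is a natural number above it.
  inv = quotient ε>0 (2^->0 0)
  δ = proj₁ inv
  arch = archimedean δ
  k = proj₁ arch

-- Multiplication of real numbers

bounded : (u : ℝ) → ∃[ M ] (0ℚ ℚ.< M × ∃[ N ] (∀ k → N ℕ.≤ k → ℚ.∣ seq u k ∣ ℚ.≤ M))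
bounded u with cauchy u 1ℚ (2^->0 0)
... | N , close = M , M>0 , N , bound
  where
  M = 1ℚ ℚ.+ ℚ.∣ seq u N ∣
  M>0 : 0ℚ ℚ.< M
  M>0 = ℚ.+-mono-<-≤ (2^->0 0) (ℚ.0≤∣p∣ (seq u N))
  bound : ∀ k → N ℕ.≤ k → ℚ.∣ seq u k ∣ ℚ.≤ M
  bound k k≥N = begin
    ℚ.∣ seq u k ∣
      ≡⟨ cong ℚ.∣_∣ (solve 2 (λ a b → a := (a :- b) :+ b) refl (seq u k) (seq u N)) ⟩
    ℚ.∣ (seq u k ℚ.- seq u N) ℚ.+ seq u N ∣
      ≤⟨ ℚ.∣p+q∣≤∣p∣+∣q∣ (seq u k ℚ.- seq u N) (seq u N) ⟩
    ℚ.∣ seq u k ℚ.- seq u N ∣ ℚ.+ ℚ.∣ seq u N ∣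
      ≤⟨ ℚ.+-monoˡ-≤ ℚ.∣ seq u N ∣ (ℚ.<⇒≤ (close k N k≥N ℕ.≤-refl)) ⟩
    M ∎
    where open ℚ.≤-Reasoning

-- Rests on `ab - cd = a(b - d) + (a - c)d`, each summand being allotted half of `ε`. Positivity of
-- `B` and `C` keeps the final estimate strict.
product-close : ∀ {a b c d B C δ γ ε} → 0ℚ ℚ.< B → 0ℚ ℚ.< C →
  ℚ.∣ a ∣ ℚ.≤ B → ℚ.∣ d ∣ ℚ.≤ C → ℚ.∣ b ℚ.- d ∣ ℚ.< δ → ℚ.∣ a ℚ.- c ∣ ℚ.< γ →
  B ℚ.* δ ≡ ½ ℚ.* ε → C ℚ.* γ ≡ ½ ℚ.* ε →
  ℚ.∣ a ℚ.* b ℚ.- c ℚ.* d ∣ ℚ.< ε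
product-close {a} {b} {c} {d} {B} {C} {δ} {γ} {ε} B>0 C>0 a≤B d≤C b-d<δ a-c<γ Bδ Cγ = begin-strict
  ℚ.∣ a ℚ.* b ℚ.- c ℚ.* d ∣
    ≡⟨ cong ℚ.∣_∣ (split a b c d) ⟩
  ℚ.∣ a ℚ.* (b ℚ.- d) ℚ.+ (a ℚ.- c) ℚ.* d ∣
    ≤⟨ ℚ.∣p+q∣≤∣p∣+∣q∣ (a ℚ.* (b ℚ.- d)) ((a ℚ.- c) ℚ.* d) ⟩
  ℚ.∣ a ℚ.* (b ℚ.- d) ∣ ℚ.+ ℚ.∣ (a ℚ.- c) ℚ.* d ∣
    ≡⟨ cong₂ ℚ._+_ (ℚ.∣p*q∣≡∣p∣*∣q∣ a (b ℚ.- d)) (ℚ.∣p*q∣≡∣p∣*∣q∣ (a ℚ.- c) d) ⟩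
  ℚ.∣ a ∣ ℚ.* ℚ.∣ b ℚ.- d ∣ ℚ.+ ℚ.∣ a ℚ.- c ∣ ℚ.* ℚ.∣ d ∣
    ≤⟨ ℚ.+-mono-≤
         (*-mono-≤-nonNeg (ℚ.<⇒≤ B>0) (ℚ.0≤∣p∣ (b ℚ.- d)) a≤B ℚ.≤-refl)
         (*-mono-≤-nonNeg (ℚ.0≤∣p∣ (a ℚ.- c)) (ℚ.0≤∣p∣ d) ℚ.≤-refl d≤C) ⟩
  B ℚ.* ℚ.∣ b ℚ.- d ∣ ℚ.+ ℚ.∣ a ℚ.- c ∣ ℚ.* C
    <⟨ ℚ.+-mono-<
         (ℚ.*-monoʳ-<-pos B {{ℚ.positive B>0}} b-d<δ)
         (ℚ.*-monoˡ-<-pos C {{ℚ.positive C>0}} a-c<γ) ⟩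
  B ℚ.* δ ℚ.+ γ ℚ.* C
    ≡⟨ cong₂ ℚ._+_ Bδ (trans (ℚ.*-comm γ C) Cγ) ⟩
  ½ ℚ.* ε ℚ.+ ½ ℚ.* ε
    ≡⟨ ½+½ ε ⟩
  ε ∎
  where
  open ℚ.≤-Reasoning
  split : ∀ a b c d → a ℚ.* b ℚ.- c ℚ.* d ≡ a ℚ.* (b ℚ.- d) ℚ.+ (a ℚ.- c) ℚ.* d
  split = solve 4 (λ a b c d → a :* b :- c :* d := a :* (b :- d) :+ (a :- c) :* d) refl

infixl 7 _·_

-- Products of reals arise because the parameter of a convex combination must itself be allowed to
-- be real: bisection delivers it only as a limit.
_·_ : ℝ → ℝ → ℝ
seq (u · v) k = seq u k ℚ.* seq v k
cauchy (u · v) ε ε>0 =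
  let B , B>0 , N₁ , u≤B = bounded u
      C , C>0 , N₂ , v≤C = bounded v
      δ , δ>0 , Bδ = quotient B>0 (½*-pos ε>0)
      γ , γ>0 , Cγ = quotient C>0 (½*-pos ε>0)
      N₃ , v-close = cauchy v δ δ>0
      N₄ , u-close = cauchy u γ γ>0
  in (N₁ ℕ.⊔ N₂) ℕ.⊔ (N₃ ℕ.⊔ N₄) , λ i j i≥ j≥ → product-close B>0 C>0
       (u≤B i (ℕ.m⊔n≤o⇒m≤o N₁ N₂ (ℕ.m⊔n≤o⇒m≤o (N₁ ℕ.⊔ N₂) _ i≥)))
       (v≤C j (ℕ.m⊔n≤o⇒n≤o N₁ N₂ (ℕ.m⊔n≤o⇒m≤o (N₁ ℕ.⊔ N₂) _ j≥)))
       (v-close i j (ℕ.m⊔n≤o⇒m≤o N₃ N₄ (ℕ.m⊔n≤o⇒n≤o (N₁ ℕ.⊔ N₂) _ i≥))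
                    (ℕ.m⊔n≤o⇒m≤o N₃ N₄ (ℕ.m⊔n≤o⇒n≤o (N₁ ℕ.⊔ N₂) _ j≥)))
       (u-close i j (ℕ.m⊔n≤o⇒n≤o N₃ N₄ (ℕ.m⊔n≤o⇒n≤o (N₁ ℕ.⊔ N₂) _ i≥))
                    (ℕ.m⊔n≤o⇒n≤o N₃ N₄ (ℕ.m⊔n≤o⇒n≤o (N₁ ℕ.⊔ N₂) _ j≥)))
       Bδ Cγ

-- Lower bounds on differences of reals

record Gap (c : ℚ) (u v : ℝ) : Set where
  constructor gap
  field
    -- The record keeps `u` and `v` visible to inference; the bare inequality unfolds to a statement
    -- about sequences from which they cannot be recovered. Upper bounds take the same form after
    -- exchanging `u` and `v` and negating `c`.
    ungap : fromℚ c < u - v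

open Gap

below⇒gap : ∀ {c u v} → u - v < fromℚ c → Gap (ℚ.- c) v u
below⇒gap {c} {u} {v} (ε , ε>0 , N , below) = gap (ε , ε>0 , N , λ k k≥N →
  <-by (below k k≥N) (regroup (seq u k) (seq v k) c ε))
  where
  regroup : ∀ a b c ε → (b ℚ.- a) ℚ.- (ℚ.- c ℚ.+ ε) ≡ c ℚ.- ((a ℚ.- b) ℚ.+ ε)
  regroup = solve 4 (λ a b c ε → (b :- a) :- (:- c :+ ε) := c :- ((a :- b) :+ ε)) refl

gap⇒below : ∀ {c u v} → Gap (ℚ.- c) v u → u - v < fromℚ c
gap⇒below {c} {u} {v} (gap (ε , ε>0 , N , g)) = ε , ε>0 , N , λ k k≥N →
  <-by (g k k≥N) (regroup (seq u k) (seq v k) c ε)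
  where
  regroup : ∀ a b c ε → c ℚ.- ((a ℚ.- b) ℚ.+ ε) ≡ (b ℚ.- a) ℚ.- (ℚ.- c ℚ.+ ε)
  regroup = solve 4 (λ a b c ε → c :- ((a :- b) :+ ε) := (b :- a) :- (:- c :+ ε)) refl

<⇒gap : ∀ {u v} → u < v → Gap 0ℚ v u
<⇒gap {u} {v} (ε , ε>0 , N , below) = gap (ε , ε>0 , N , λ k k≥N →
  <-by (below k k≥N) (regroup (seq u k) (seq v k) ε))
  where
  regroup : ∀ a b ε → (b ℚ.- a) ℚ.- (0ℚ ℚ.+ ε) ≡ b ℚ.- (a ℚ.+ ε)
  regroup = solve 3 (λ a b ε → (b :- a) :- (con 0ℚ :+ ε) := b :- (a :+ ε)) refl

gap⇒< : ∀ {u v} → Gap 0ℚ v u → u < v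
gap⇒< {u} {v} (gap (ε , ε>0 , N , g)) = ε , ε>0 , N , λ k k≥N →
  <-by (g k k≥N) (regroup (seq u k) (seq v k) ε)
  where
  regroup : ∀ a b ε → b ℚ.- (a ℚ.+ ε) ≡ (b ℚ.- a) ℚ.- (0ℚ ℚ.+ ε)
  regroup = solve 3 (λ a b ε → b :- (a :+ ε) := (b :- a) :- (con 0ℚ :+ ε)) refl

-1<⇒gap : ∀ {u v} → u - 1ℝ < v → Gap (ℚ.- 1ℚ) v u
-1<⇒gap {u} {v} (ε , ε>0 , N , below) = gap (ε , ε>0 , N , λ k k≥N →
  <-by (below k k≥N) (regroup (seq u k) (seq v k) ε))
  where
  regroup : ∀ a b ε → (b ℚ.- a) ℚ.- (ℚ.- 1ℚ ℚ.+ ε) ≡ b ℚ.- ((a ℚ.- 1ℚ) ℚ.+ ε)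
  regroup = solve 3 (λ a b ε → (b :- a) :- (con (ℚ.- 1ℚ) :+ ε) := b :- ((a :- con 1ℚ) :+ ε)) refl

gap⇒-1< : ∀ {u v} → Gap (ℚ.- 1ℚ) v u → u - 1ℝ < v
gap⇒-1< {u} {v} (gap (ε , ε>0 , N , g)) = ε , ε>0 , N , λ k k≥N →
  <-by (g k k≥N) (regroup (seq u k) (seq v k) ε)
  where
  regroup : ∀ a b ε → b ℚ.- ((a ℚ.- 1ℚ) ℚ.+ ε) ≡ (b ℚ.- a) ℚ.- (ℚ.- 1ℚ ℚ.+ ε)
  regroup = solve 3 (λ a b ε → b :- ((a :- con 1ℚ) :+ ε) := (b :- a) :- (con (ℚ.- 1ℚ) :+ ε)) refl

gap-trans : ∀ {c d u v w} → Gap c u v → Gap d v w → Gap (c ℚ.+ d) u w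
gap-trans {c} {d} {u} {v} {w} (gap (ε , ε>0 , M , uv)) (gap (δ , δ>0 , N , vw)) =
  gap (ε ℚ.+ δ , ℚ.+-mono-< ε>0 δ>0 , M ℕ.⊔ N , λ k k≥ →
    subst₂ ℚ._<_ (left c d ε δ) (right (seq u k) (seq v k) (seq w k))
      (ℚ.+-mono-< (uv k (ℕ.m⊔n≤o⇒m≤o M N k≥)) (vw k (ℕ.m⊔n≤o⇒n≤o M N k≥))))
  where
  left : ∀ c d ε δ → (c ℚ.+ ε) ℚ.+ (d ℚ.+ δ) ≡ c ℚ.+ d ℚ.+ (ε ℚ.+ δ)
  left = solve 4 (λ c d ε δ → (c :+ ε) :+ (d :+ δ) := c :+ d :+ (ε :+ δ)) refl
  right : ∀ a b c → (a ℚ.- b) ℚ.+ (b ℚ.- c) ≡ a ℚ.- c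
  right = solve 3 (λ a b c → (a :- b) :+ (b :- c) := a :- c) refl

-- Half of the margin `ε` remains as a margin; the other half is split into two equal parts `δ`, one
-- for each coordinate that moves in `above-open`.
gap-slack : ∀ {c u v} → Gap c u v → ∃[ δ ] (0ℚ ℚ.< δ × Gap (c ℚ.+ (δ ℚ.+ δ)) u v)
gap-slack {c} {u} {v} (gap (ε , ε>0 , N , g)) =
  ½ ℚ.* (½ ℚ.* ε) , ½*-pos (½*-pos ε>0) , gap (½ ℚ.* ε , ½*-pos ε>0 , N , λ k k≥N →
    subst (ℚ._< seq u k ℚ.- seq v k) (regroup c ε) (g k k≥N))
  where
  regroup : ∀ c ε → c ℚ.+ ε ≡ c ℚ.+ (½ ℚ.* (½ ℚ.* ε) ℚ.+ ½ ℚ.* (½ ℚ.* ε)) ℚ.+ ½ ℚ.* ε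
  regroup = solve 2 (λ c ε → c :+ ε :=
    c :+ (con ½ :* (con ½ :* ε) :+ con ½ :* (con ½ :* ε)) :+ con ½ :* ε) refl

gap-≤ : ∀ {c d u v} → d ℚ.≤ c → Gap c u v → Gap d u v
gap-≤ d≤c (gap (ε , ε>0 , N , g)) =
  gap (ε , ε>0 , N , λ k k≥N → ℚ.≤-<-trans (ℚ.+-monoˡ-≤ ε d≤c) (g k k≥N))

gap-irrefl : ∀ {c u} → 0ℚ ℚ.≤ c → ¬ Gap c u u
gap-irrefl {c} {u} 0≤c (gap (ε , ε>0 , N , g)) = ℚ.<-irrefl refl (ℚ.<-≤-trans
  (subst (c ℚ.+ ε ℚ.<_) (ℚ.+-inverseʳ (seq u N)) (g N ℕ.≤-refl))
  (ℚ.+-mono-≤ 0≤c (ℚ.<⇒≤ ε>0)))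

gap-asym : ∀ {c u v} → Gap c u v → ¬ Gap (ℚ.- c) v u
gap-asym {c} uv vu = gap-irrefl (ℚ.≤-reflexive (sym (ℚ.+-inverseʳ c))) (gap-trans uv vu)

fromℚ-gap : ∀ {c p q} → c ℚ.+ q ℚ.< p → Gap c (fromℚ p) (fromℚ q)
fromℚ-gap {c} {p} {q} c+q<p = gap (½ ℚ.* ε , ½*-pos ε>0 , 0 , λ _ _ →
  <-by (½*-pos ε>0) (regroup c p q))
  where
  ε = p ℚ.- q ℚ.- c
  ε>0 : 0ℚ ℚ.< ε
  ε>0 = <-by c+q<p (solve 3 (λ c p q → (p :- q :- c) :- con 0ℚ := p :- (c :+ q)) refl c p q)
  regroup : ∀ c p q → (p ℚ.- q) ℚ.- (c ℚ.+ ½ ℚ.* (p ℚ.- q ℚ.- c)) ≡ ½ ℚ.* (p ℚ.- q ℚ.- c) ℚ.- 0ℚ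
  regroup = solve 3 (λ c p q → (p :- q) :- (c :+ con ½ :* (p :- q :- c)) :=
    con ½ :* (p :- q :- c) :- con 0ℚ) refl

-- Half-spaces are open

above-open : ∀ {n} (A : Pred (Point n) 0ℓ) c i j → RelativelyOpen A (Above (fromℚ c) i j)
above-open A c i j x _ above =
  let δ , δ>0 , slack = gap-slack (gap {c} {x i} {x j} above) in
  δ , δ>0 , λ y _ near → ungap (gap-≤ (ℚ.≤-reflexive (regroup c δ))
    (gap-trans (below⇒gap {δ} {x i} {y i} (proj₁ (near i)))
      (gap-trans slack (below⇒gap {δ} {y j} {x j} (proj₂ (near j))))))
  where
  regroup : ∀ c δ → c ≡ ℚ.- δ ℚ.+ (c ℚ.+ (δ ℚ.+ δ) ℚ.+ ℚ.- δ)
  regroup = solve 2 (λ c δ → c := :- δ :+ (c :+ (δ :+ δ) :+ :- δ)) refl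

below-open : ∀ {n} (A : Pred (Point n) 0ℓ) c i j → RelativelyOpen A (Below (fromℚ c) i j)
below-open A c i j x Ax below =
  let ε , ε>0 , ball = above-open A (ℚ.- c) j i x Ax (ungap (below⇒gap {c} {x i} {x j} below)) in
  ε , ε>0 , λ y Ay near → gap⇒below {c} {y i} {y j} (gap (ball y Ay near))

-- Convex sets are connected

mix : ℝ → ℝ → ℝ → ℝ
mix s u v = u - s · (u - v)

mixPoint : ∀ {n} → ℝ → Point n → Point n → Point n
mixPoint s x y i = mix s (x i) (y i)

InUnit : ℚ → Set
InUnit t = 0ℚ ℚ.≤ t × t ℚ.≤ 1ℚ

-- The parameter is required to lie in the unit interval term by term, which reduces convexity of a
-- half-space to an inequality between rationals. Rational constants and the limit of a bisection
-- both have this form.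
Convex : ∀ {n} → Pred (Point n) 0ℓ → Set
Convex A = ∀ s → (∀ k → InUnit (seq s k)) → ∀ x y → A x → A y → A (mixPoint s x y)

-- A convex combination is at least the smaller of its ends; the case distinction finds out which
-- end that is.
mix-< : ∀ {a p q} s → InUnit s → a ℚ.< p → a ℚ.< q → a ℚ.< p ℚ.- s ℚ.* (p ℚ.- q)
mix-< {a} {p} {q} s (0≤s , s≤1) a<p a<q with ℚ.≤-total p q
... | inj₁ p≤q = ℚ.<-≤-trans a<p (≤-by
  (ℚ.*-monoˡ-≤-nonNeg s {{ℚ.nonNegative 0≤s}} p≤q)
  (solve 3 (λ p q s → (p :- s :* (p :- q)) :- p := s :* q :- s :* p) refl p q s))
... | inj₂ q≤p = ℚ.<-≤-trans a<q (≤-by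
  (ℚ.*-monoˡ-≤-nonNeg (1ℚ ℚ.- s) {{ℚ.nonNegative 0≤1-s}} q≤p)
  (solve 3 (λ p q s → (p :- s :* (p :- q)) :- q := (con 1ℚ :- s) :* p :- (con 1ℚ :- s) :* q) refl p q s))
  where
  0≤1-s : 0ℚ ℚ.≤ 1ℚ ℚ.- s
  0≤1-s = ≤-by s≤1 (solve 1 (λ s → (con 1ℚ :- s) :- con 0ℚ := con 1ℚ :- s) refl s)

-- The difference of two coordinates is mixed with the same parameter as the coordinates, so `mix-<`
-- applies to it, with the smaller of the two margins.
above-convex : ∀ {n} c i j → Convex {n} (Above (fromℚ c) i j)
above-convex c i j s s∈I x y (ε , ε>0 , M , x-above) (δ , δ>0 , N , y-above) =
  ε ℚ.⊓ δ , ⊓-pos , M ℕ.⊔ N , λ k k≥ →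
    subst (c ℚ.+ (ε ℚ.⊓ δ) ℚ.<_)
      (regroup (seq (x i) k) (seq (x j) k) (seq (y i) k) (seq (y j) k) (seq s k))
      (mix-< (seq s k) (s∈I k)
        (ℚ.≤-<-trans (ℚ.+-monoʳ-≤ c (ℚ.p⊓q≤p ε δ)) (x-above k (ℕ.m⊔n≤o⇒m≤o M N k≥)))
        (ℚ.≤-<-trans (ℚ.+-monoʳ-≤ c (ℚ.p⊓q≤q ε δ)) (y-above k (ℕ.m⊔n≤o⇒n≤o M N k≥))))
  where
  ⊓-pos : 0ℚ ℚ.< ε ℚ.⊓ δ
  ⊓-pos with ℚ.⊓-sel ε δ
  ... | inj₁ eq = subst (0ℚ ℚ.<_) (sym eq) ε>0
  ... | inj₂ eq = subst (0ℚ ℚ.<_) (sym eq) δ>0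
  regroup : ∀ a b a′ b′ s → (a ℚ.- b) ℚ.- s ℚ.* ((a ℚ.- b) ℚ.- (a′ ℚ.- b′)) ≡
            (a ℚ.- s ℚ.* (a ℚ.- a′)) ℚ.- (b ℚ.- s ℚ.* (b ℚ.- b′))
  regroup = solve 5 (λ a b a′ b′ s → (a :- b) :- s :* ((a :- b) :- (a′ :- b′)) :=
            (a :- s :* (a :- a′)) :- (b :- s :* (b :- b′))) refl

below-convex : ∀ {n} c i j → Convex {n} (Below (fromℚ c) i j)
below-convex c i j s s∈I x y x-below y-below =
  gap⇒below {c} {mix s (x i) (y i)} {mix s (x j) (y j)} (gap (above-convex (ℚ.- c) j i s s∈I x y
    (ungap (below⇒gap {c} {x i} {x j} x-below)) (ungap (below⇒gap {c} {y i} {y j} y-below))))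

-- `Near` demands a strict inequality with a positive margin. With `ε/2` as the margin, a distance
-- of at most `ε/4` leaves room to spare.
near⁺ : ∀ {n ε} (x y : Point n) → 0ℚ ℚ.< ε →
        (∀ i → ∃[ N ] (∀ k → N ℕ.≤ k → ℚ.∣ seq (x i) k ℚ.- seq (y i) k ∣ ℚ.≤ ½ ℚ.* (½ ℚ.* ε))) →
        Near ε x y
near⁺ {ε = ε} x y ε>0 close i =
  let N , within = close i in
    (½ ℚ.* ε , ½*-pos ε>0 , N , λ k k≥N → below (ℚ.≤-trans (p≤∣p∣ (d k)) (within k k≥N)))
  , (½ ℚ.* ε , ½*-pos ε>0 , N , λ k k≥N → below
      (ℚ.≤-trans (subst (ℚ._≤ ℚ.∣ d k ∣) (flip-sub (seq (x i) k) (seq (y i) k)) (-p≤∣p∣ (d k)))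
        (within k k≥N)))
  where
  d : ℕ → ℚ
  d k = seq (x i) k ℚ.- seq (y i) k
  flip-sub : ∀ a b → ℚ.- (a ℚ.- b) ≡ b ℚ.- a
  flip-sub = solve 2 (λ a b → :- (a :- b) := b :- a) refl
  below : ∀ {p} → p ℚ.≤ ½ ℚ.* (½ ℚ.* ε) → p ℚ.+ ½ ℚ.* ε ℚ.< ε
  below {p} p≤ = subst (p ℚ.+ ½ ℚ.* ε ℚ.<_) (½+½ ε)
    (ℚ.+-mono-<-≤ (ℚ.≤-<-trans p≤ (½*-≤ (½*-pos ε>0))) (ℚ.≤-refl {½ ℚ.* ε}))

upperBound : ∀ {n} (f : Fin n → ℚ) → ∃[ M ] (0ℚ ℚ.< M × (∀ i → f i ℚ.≤ M))
upperBound {zero}  f = 1ℚ , 2^->0 0 , λ ()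
upperBound {suc n} f =
  let M , M>0 , f≤M = upperBound (λ i → f (suc i)) in
  f zero ℚ.⊔ M , ℚ.<-≤-trans M>0 (ℚ.p≤q⊔p (f zero) M) ,
  λ { zero → ℚ.p≤p⊔q (f zero) M ; (suc i) → ℚ.≤-trans (f≤M i) (ℚ.p≤q⊔p (f zero) M) }

-- Passing from `s` to `t` moves coordinate `i` by `(s - t)(x_i - y_i)` up to sign. Hence `ε/4`
-- divided by a common bound `M` of these finitely many differences is a modulus of continuity.
mix-near : ∀ {n ε} (x y : Point n) → 0ℚ ℚ.< ε → ∃[ δ ] (0ℚ ℚ.< δ × (∀ s t →
  (∃[ N ] (∀ k → N ℕ.≤ k → ℚ.∣ seq s k ℚ.- seq t k ∣ ℚ.≤ δ)) →
  Near ε (mixPoint s x y) (mixPoint t x y)))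
mix-near {ε = ε} x y ε>0 =
  let M , M>0 , bound≤M = upperBound (λ i → proj₁ (bounded (x i - y i)))
      δ , δ>0 , Mδ = quotient M>0 (½*-pos (½*-pos ε>0))
  in δ , δ>0 , λ s t (N , s≈t) → near⁺ (mixPoint s x y) (mixPoint t x y) ε>0 λ i →
    let _ , _ , Nᵢ , d≤ = bounded (x i - y i) in
    N ℕ.⊔ Nᵢ , λ k k≥ → subst₂ ℚ._≤_
      (trans (sym (ℚ.∣p*q∣≡∣p∣*∣q∣ (seq (x i - y i) k) (seq s k ℚ.- seq t k)))
        (trans (sym (ℚ.∣-p∣≡∣p∣ (seq (x i - y i) k ℚ.* (seq s k ℚ.- seq t k))))
          (cong ℚ.∣_∣ (regroup (seq (x i) k) (seq (x i - y i) k) (seq s k) (seq t k)))))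
      Mδ
      (*-mono-≤-nonNeg (ℚ.<⇒≤ M>0) (ℚ.0≤∣p∣ (seq s k ℚ.- seq t k))
        (ℚ.≤-trans (d≤ k (ℕ.m⊔n≤o⇒n≤o N Nᵢ k≥)) (bound≤M i))
        (s≈t k (ℕ.m⊔n≤o⇒m≤o N Nᵢ k≥)))
  where
  regroup : ∀ a d s t → ℚ.- (d ℚ.* (s ℚ.- t)) ≡ (a ℚ.- s ℚ.* d) ℚ.- (a ℚ.- t ℚ.* d)
  regroup = solve 4 (λ a d s t → :- (d :* (s :- t)) := (a :- s :* d) :- (a :- t :* d)) refl

-- The ends of a segment have the same terms as `x` and `y` without being identical to them, and `U`
-- and `V` are not assumed to respect equality of reals. Openness carries membership across.
≡⇒near : ∀ {n ε} (x y : Point n) → 0ℚ ℚ.< ε → (∀ i k → seq (x i) k ≡ seq (y i) k) → Near ε x y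
≡⇒near {ε = ε} x y ε>0 x≡y = near⁺ x y ε>0 λ i → 0 , λ k _ → subst (ℚ._≤ ½ ℚ.* (½ ℚ.* ε))
  (sym (cong ℚ.∣_∣ (trans (cong (ℚ._- seq (y i) k) (x≡y i k)) (ℚ.+-inverseʳ (seq (y i) k)))))
  (ℚ.<⇒≤ (½*-pos (½*-pos ε>0)))

-- A substitute for the supremum argument that needs no completeness beyond Cauchy sequences: an
-- alternative at each rational midpoint is enough to find a real that points of both kinds
-- approach.
module Bisection
  (P Q : ℚ → Set) (decide : ∀ t → InUnit t → P t ⊎ Q t) (P0 : P 0ℚ) (Q1 : Q 1ℚ)
  where

  record Interval (k : ℕ) : Set where
    field
      lo   : ℚ
      0≤lo : 0ℚ ℚ.≤ lo
      hi≤1 : lo ℚ.+ 2^- k ℚ.≤ 1ℚ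
      P-lo : P lo
      Q-hi : Q (lo ℚ.+ 2^- k)

  open Interval

  lo≤lo+2^- : ∀ p k → p ℚ.≤ p ℚ.+ 2^- k
  lo≤lo+2^- p k = subst (ℚ._≤ p ℚ.+ 2^- k) (ℚ.+-identityʳ p) (ℚ.+-monoʳ-≤ p (ℚ.<⇒≤ (2^->0 k)))

  mid+ : ∀ p k → (p ℚ.+ 2^- (suc k)) ℚ.+ 2^- (suc k) ≡ p ℚ.+ 2^- k
  mid+ p k = trans (ℚ.+-assoc p _ _) (cong (p ℚ.+_) (½+½ (2^- k)))

  mid≤hi : ∀ p k → p ℚ.+ 2^- (suc k) ℚ.≤ p ℚ.+ 2^- k
  mid≤hi p k = ℚ.+-monoʳ-≤ p (ℚ.<⇒≤ (½*-≤ (2^->0 k)))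

  halve : ∀ {k} (I : Interval k) → Σ[ J ∈ Interval (suc k) ]
    (lo I ℚ.≤ lo J × lo J ℚ.+ 2^- (suc k) ℚ.≤ lo I ℚ.+ 2^- k)
  halve {k} I = from (decide mid (0≤mid , ℚ.≤-trans (mid≤hi (lo I) k) (hi≤1 I)))
    where
    mid = lo I ℚ.+ 2^- (suc k)
    0≤mid = ℚ.≤-trans (0≤lo I) (lo≤lo+2^- (lo I) (suc k))
    from : P mid ⊎ Q mid → Σ[ J ∈ Interval (suc k) ]
      (lo I ℚ.≤ lo J × lo J ℚ.+ 2^- (suc k) ℚ.≤ lo I ℚ.+ 2^- k)
    from (inj₁ P-mid) = record
      { lo = mid ; 0≤lo = 0≤mid ; P-lo = P-mid
      ; hi≤1 = subst (ℚ._≤ 1ℚ) (sym (mid+ (lo I) k)) (hi≤1 I)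
      ; Q-hi = subst Q (sym (mid+ (lo I) k)) (Q-hi I) } ,
      lo≤lo+2^- (lo I) (suc k) , ℚ.≤-reflexive (mid+ (lo I) k)
    from (inj₂ Q-mid) = record
      { lo = lo I ; 0≤lo = 0≤lo I ; P-lo = P-lo I
      ; hi≤1 = ℚ.≤-trans (mid≤hi (lo I) k) (hi≤1 I) ; Q-hi = Q-mid } ,
      ℚ.≤-refl , mid≤hi (lo I) k

  interval : ∀ k → Interval k
  interval zero = record
    { lo = 0ℚ ; 0≤lo = ℚ.≤-refl ; hi≤1 = ℚ.≤-refl ; P-lo = P0 ; Q-hi = Q1 }
  interval (suc k) = proj₁ (halve (interval k))

  lower upper : ℕ → ℚ
  lower k = lo (interval k)
  upper k = lower k ℚ.+ 2^- k

  nested : ∀ {i j} → i ℕ.≤ j → lower i ℚ.≤ lower j × upper j ℚ.≤ upper i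
  nested i≤j = go (ℕ.≤⇒≤′ i≤j)
    where
    go : ∀ {i j} → i ℕ.≤′ j → lower i ℚ.≤ lower j × upper j ℚ.≤ upper i
    go (ℕ.≤′-reflexive refl) = ℚ.≤-refl , ℚ.≤-refl
    go (ℕ.≤′-step {j} p) =
      ℚ.≤-trans (proj₁ (go p)) (proj₁ (proj₂ (halve (interval j)))) ,
      ℚ.≤-trans (proj₂ (proj₂ (halve (interval j)))) (proj₂ (go p))

  width : ∀ {a b p} k → p ℚ.≤ a → a ℚ.≤ p ℚ.+ 2^- k → p ℚ.≤ b → b ℚ.≤ p ℚ.+ 2^- k →
          ℚ.∣ a ℚ.- b ∣ ℚ.≤ 2^- k
  width {a} {b} {p} k p≤a a≤ p≤b b≤ = ∣p∣≤
    (≤-by (ℚ.+-mono-≤ a≤ p≤b) (regroup a b p (2^- k)))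
    (≤-by (ℚ.+-mono-≤ b≤ p≤a) (regroup′ a b p (2^- k)))
    where
    regroup : ∀ a b p h → h ℚ.- (a ℚ.- b) ≡ ((p ℚ.+ h) ℚ.+ b) ℚ.- (a ℚ.+ p)
    regroup = solve 4 (λ a b p h → h :- (a :- b) := ((p :+ h) :+ b) :- (a :+ p)) refl
    regroup′ : ∀ a b p h → h ℚ.- ℚ.- (a ℚ.- b) ≡ ((p ℚ.+ h) ℚ.+ a) ℚ.- (b ℚ.+ p)
    regroup′ = solve 4 (λ a b p h → h :- :- (a :- b) := ((p :+ h) :+ a) :- (b :+ p)) refl

  lower≤upper : ∀ {i j} → i ℕ.≤ j → lower j ℚ.≤ upper i
  lower≤upper {i} {j} i≤j = ℚ.≤-trans (lo≤lo+2^- (lower j) j) (proj₂ (nested i≤j))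

  limit : ℝ
  seq limit = lower
  cauchy limit ε ε>0 =
    let N , 2^-N≤ = 2^-small (½ ℚ.* ε) (½*-pos ε>0) in
    N , λ i j i≥N j≥N → ℚ.≤-<-trans
      (width N (proj₁ (nested i≥N)) (lower≤upper i≥N) (proj₁ (nested j≥N)) (lower≤upper j≥N))
      (ℚ.≤-<-trans 2^-N≤ (½*-≤ ε>0))

  limit∈I : ∀ k → InUnit (seq limit k)
  limit∈I k = 0≤lo (interval k) , ℚ.≤-trans (lo≤lo+2^- (lower k) k) (hi≤1 (interval k))

  -- Neither `P` nor `Q` need pass to the limit; what survives is that rational points of each kind
  -- lie arbitrarily close to it.
  Approached : (ℚ → Set) → Set
  Approached R = ∀ δ → 0ℚ ℚ.< δ →
    ∃[ t ] (InUnit t × R t × ∃[ N ] (∀ k → N ℕ.≤ k → ℚ.∣ seq limit k ℚ.- t ∣ ℚ.≤ δ))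

  approached-P : Approached P
  approached-P δ δ>0 =
    let N , 2^-N≤ = 2^-small δ δ>0 in
    lower N , limit∈I N , P-lo (interval N) , N , λ k k≥N → ℚ.≤-trans
      (width N (proj₁ (nested k≥N)) (lower≤upper k≥N) ℚ.≤-refl (lo≤lo+2^- (lower N) N)) 2^-N≤

  approached-Q : Approached Q
  approached-Q δ δ>0 =
    let N , 2^-N≤ = 2^-small δ δ>0 in
    upper N , (ℚ.≤-trans (0≤lo (interval N)) (lo≤lo+2^- (lower N) N) , hi≤1 (interval N)) ,
    Q-hi (interval N) , N , λ k k≥N → ℚ.≤-trans
      (width N (proj₁ (nested k≥N)) (lower≤upper k≥N) (lo≤lo+2^- (lower N) N) ℚ.≤-refl) 2^-N≤

-- The cover puts the limit point `z` into `U` or into `V`. The ball that openness provides there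
-- then contains a point of the segment of the other kind, against disjointness.
convex⇒connected : ∀ {n} (A : Pred (Point n) 0ℓ) → Convex A → Connected A
convex⇒connected {n} A convex U V U-open V-open cover disjoint x y Ax Ux Ay Vy =
  Sum.[ clash-U , clash-V ]′ (cover z Az)
  where
  at : ℚ → Point n
  at t = mixPoint (fromℚ t) x y

  A-at : ∀ t → InUnit t → A (at t)
  A-at t t∈I = convex (fromℚ t) (λ _ → t∈I) x y Ax Ay

  0≤1 : 0ℚ ℚ.≤ 1ℚ
  0≤1 = ℚ.<⇒≤ (2^->0 0)

  U-0 : U (at 0ℚ)
  U-0 = let ε , ε>0 , ball = U-open x Ax Ux in
    ball (at 0ℚ) (A-at 0ℚ (ℚ.≤-refl , 0≤1)) (≡⇒near x (at 0ℚ) ε>0 λ i k →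
      solve 2 (λ a b → a := a :- con 0ℚ :* (a :- b)) refl (seq (x i) k) (seq (y i) k))

  V-1 : V (at 1ℚ)
  V-1 = let ε , ε>0 , ball = V-open y Ay Vy in
    ball (at 1ℚ) (A-at 1ℚ (0≤1 , ℚ.≤-refl)) (≡⇒near y (at 1ℚ) ε>0 λ i k →
      solve 2 (λ a b → b := a :- con 1ℚ :* (a :- b)) refl (seq (x i) k) (seq (y i) k))

  open Bisection (λ t → U (at t)) (λ t → V (at t)) (λ t t∈I → cover (at t) (A-at t t∈I)) U-0 V-1

  z : Point n
  z = mixPoint limit x y

  Az : A z
  Az = convex limit limit∈I x y Ax Ay

  clash-U : ¬ U z
  clash-U Uz =
    let ε , ε>0 , ball = U-open z Az Uz
        δ , δ>0 , near = mix-near x y ε>0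
        t , t∈I , Vt , close = approached-Q δ δ>0
    in disjoint (at t) (A-at t t∈I) (ball (at t) (A-at t t∈I) (near limit (fromℚ t) close)) Vt

  clash-V : ¬ V z
  clash-V Vz =
    let ε , ε>0 , ball = V-open z Az Vz
        δ , δ>0 , near = mix-near x y ε>0
        t , t∈I , Ut , close = approached-P δ δ>0
    in disjoint (at t) (A-at t t∈I) Ut (ball (at t) (A-at t t∈I) (near limit (fromℚ t) close))

-- Components and sides of hyperplanes

Agree : ∀ {n} → Point n → Point n → Set
Agree x y = ∀ i j → i Fin.< j →
  ((Above 0ℝ i j x → Above 0ℝ i j y) × (Below 0ℝ i j x → Below 0ℝ i j y)) ×
  ((Above 1ℝ i j x → Above 1ℝ i j y) × (Below 1ℝ i j x → Below 1ℝ i j y))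

-- `Agree x` itself is the connected set. It is convex, being cut out by half-spaces under
-- hypotheses about `x` alone, and it stays in the complement because the sides known for `x` are
-- passed on to its points.
agree⇒sameComponent : ∀ {n} {x y : Point n} → ShiComplement x → Agree x y →
                      SameComponent ShiComplement x y
agree⇒sameComponent {x = x} {y} Sx x~y =
  Agree x , inside , convex⇒connected (Agree x) convex ,
  (λ _ _ _ → ((λ p → p) , (λ p → p)) , ((λ p → p) , (λ p → p))) , x~y
  where
  inside : ∀ z → Agree x z → ShiComplement z
  inside z x~z i j i<j =
    let (a₀ , b₀) , (a₁ , b₁) = x~z i j i<j
        s₀ , s₁ = Sx i j i<j
    in Sum.map b₀ a₀ s₀ , Sum.map b₁ a₁ s₁

  convex : Convex (Agree x)
  convex s s∈I u v x~u x~v i j i<j =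
    let (a₀ , b₀) , (a₁ , b₁) = x~u i j i<j
        (a₀′ , b₀′) , (a₁′ , b₁′) = x~v i j i<j
    in ((λ p → above-convex 0ℚ i j s s∈I u v (a₀ p) (a₀′ p)) ,
        (λ p → below-convex 0ℚ i j s s∈I u v (b₀ p) (b₀′ p))) ,
       ((λ p → above-convex 1ℚ i j s s∈I u v (a₁ p) (a₁′ p)) ,
        (λ p → below-convex 1ℚ i j s s∈I u v (b₁ p) (b₁′ p)))

above⇒¬below : ∀ {n} (x : Point n) c i j → Above (fromℚ c) i j x → ¬ Below (fromℚ c) i j x
above⇒¬below x c i j above below =
  gap-asym {c} {x i} {x j} (gap above) (below⇒gap {c} {x i} {x j} below)

-- Inside the complement the two half-spaces of a hyperplane are disjoint, relatively open and
-- cover, so a connected subset cannot meet both.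
sameComponent⇒agree : ∀ {n} {x y : Point n} → SameComponent ShiComplement x y → Agree x y
sameComponent⇒agree {x = x} {y} (A , A⊆S , connected , Ax , Ay) i j i<j =
  oneSide 0ℚ (λ z Sz → proj₁ (Sz i j i<j)) , oneSide 1ℚ (λ z Sz → proj₂ (Sz i j i<j))
  where
  oneSide : ∀ c →
    (∀ z → ShiComplement z → Below (fromℚ c) i j z ⊎ Above (fromℚ c) i j z) →
    (Above (fromℚ c) i j x → Above (fromℚ c) i j y) ×
    (Below (fromℚ c) i j x → Below (fromℚ c) i j y)
  oneSide c sides = above , below
    where
    above : Above (fromℚ c) i j x → Above (fromℚ c) i j y
    above x-above with sides y (A⊆S y Ay)
    ... | inj₂ y-above = y-above
    ... | inj₁ y-below = ⊥-elim (connected (Above (fromℚ c) i j) (Below (fromℚ c) i j)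
      (above-open A c i j) (below-open A c i j)
      (λ z Az → Sum.swap (sides z (A⊆S z Az)))
      (λ z _ → above⇒¬below z c i j) x y Ax x-above Ay y-below)
    below : Below (fromℚ c) i j x → Below (fromℚ c) i j y
    below x-below with sides y (A⊆S y Ay)
    ... | inj₁ y-below = y-below
    ... | inj₂ y-above = ⊥-elim (connected (Below (fromℚ c) i j) (Above (fromℚ c) i j)
      (below-open A c i j) (above-open A c i j)
      (λ z Az → sides z (A⊆S z Az))
      (λ z _ b a → above⇒¬below z c i j a b) x y Ax x-below Ay y-above)

-- The base region

base-decreasing : ∀ {n} (x : Point n) → BaseRegion x → ∀ {i j} → i Fin.< j → Gap 0ℚ (x i) (x j)
base-decreasing {n} x (consecutive , _) {i} {j} i<j =
  go (Fin.toℕ j ℕ.∸ suc (Fin.toℕ i)) i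
    (trans (sym (ℕ.m∸n+n≡m i<j)) (ℕ.+-suc (Fin.toℕ j ℕ.∸ suc (Fin.toℕ i)) (Fin.toℕ i)))
  where
  -- `d` is the number of indices strictly between `i` and `j`; the inequalities between neighbours
  -- are telescoped.
  go : ∀ d i → Fin.toℕ j ≡ suc (d ℕ.+ Fin.toℕ i) → Gap 0ℚ (x i) (x j)
  go zero    i eq = <⇒gap (consecutive i j eq)
  go (suc d) i eq = gap-trans {0ℚ} {0ℚ} (<⇒gap (consecutive i m toℕ-m))
    (go d m (trans eq (cong suc (sym (trans (cong (d ℕ.+_) toℕ-m) (ℕ.+-suc d (Fin.toℕ i)))))))
    where
    1+i<n : suc (Fin.toℕ i) ℕ.< n
    1+i<n = ℕ.≤-<-trans (subst (suc (Fin.toℕ i) ℕ.≤_) (sym eq)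
      (ℕ.s≤s (ℕ.m≤n+m (Fin.toℕ i) (suc d)))) (Fin.toℕ<n j)
    m = Fin.fromℕ< 1+i<n
    toℕ-m : Fin.toℕ m ≡ suc (Fin.toℕ i)
    toℕ-m = Fin.toℕ-fromℕ< 1+i<n

base-above : ∀ {n} (x : Point n) → BaseRegion x → ∀ {i j} → i Fin.< j → Above 0ℝ i j x
base-above x base i<j = ungap (base-decreasing x base i<j)

-- By monotonicity `x_i - x_j` is at most the difference of the first and the last coordinate, which
-- the wrap-around condition bounds by 1.
base-below : ∀ {n} (x : Point n) → BaseRegion x → ∀ {i j} → i Fin.< j → Below 1ℝ i j x
base-below {suc n} x base@(_ , wrap) {i} {j} i<j = gap⇒below {1ℚ} {x i} {x j}
  (toFirst i (fromLast j (-1<⇒gap (wrap zero (Fin.fromℕ n) refl (cong suc (Fin.toℕ-fromℕ n))))))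
  where
  toFirst : ∀ i {u} → Gap (ℚ.- 1ℚ) u (x zero) → Gap (ℚ.- 1ℚ) u (x i)
  toFirst zero    g = g
  toFirst (suc i) g = gap-trans {ℚ.- 1ℚ} {0ℚ} g (base-decreasing x base (ℕ.s≤s ℕ.z≤n))
  fromLast : ∀ j {v} → Gap (ℚ.- 1ℚ) (x (Fin.fromℕ n)) v → Gap (ℚ.- 1ℚ) (x j) v
  fromLast j g with Fin.<-cmp j (Fin.fromℕ n)
  ... | tri< j<n _ _  = gap-trans {0ℚ} {ℚ.- 1ℚ} (base-decreasing x base j<n) g
  ... | tri≈ _ refl _ = g
  ... | tri> _ _ n<j  = ⊥-elim (ℕ.<-irrefl refl
    (ℕ.<-≤-trans n<j (subst (Fin.toℕ j ℕ.≤_) (sym (Fin.toℕ-fromℕ n)) (Fin.toℕ≤pred[n] j))))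

-- Realising a down-set of pairs of positions by coordinates

greatest : ∀ {n} (f : Fin (suc n) → ℚ) → ∃[ i ] (∀ j → f j ℚ.≤ f i)
greatest {zero}  f = zero , λ { zero → ℚ.≤-refl }
greatest {suc n} f with greatest (λ i → f (suc i))
... | i , f≤fi with ℚ.≤-total (f zero) (f (suc i))
...   | inj₁ f0≤ = suc i , λ { zero → f0≤ ; (suc j) → f≤fi j }
...   | inj₂ ≤f0 = zero , λ { zero → ℚ.≤-refl ; (suc j) → ℚ.≤-trans (f≤fi j) ≤f0 }

least : ∀ {n} (f : Fin (suc n) → ℚ) → ∃[ i ] (∀ j → f i ℚ.≤ f j)
least f =
  let i , greatest-i = greatest (λ j → ℚ.- f j) in
  i , λ j → ≤-by (greatest-i j) (solve 2 (λ a b → b :- a := (:- a) :- (:- b)) refl (f i) (f j))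

-- Uses density between the largest lower and the smallest upper bound. Without any bounds every
-- value will do, hence `0ℚ`.
between : ∀ {n} (l u : Fin n → ℚ) → (∀ i j → l i ℚ.< u j) → ∃[ z ] (∀ i → l i ℚ.< z × z ℚ.< u i)
between {zero}  l u l<u = 0ℚ , λ ()
between {suc n} l u l<u =
  let i , l≤ = greatest l
      j , ≤u = least u
      z , l<z , z<u = ℚ.<-dense (l<u i j)
  in z , λ k → ℚ.≤-<-trans (l≤ k) l<z , ℚ.<-≤-trans z<u (≤u k)

p-1<p : ∀ p → p ℚ.- 1ℚ ℚ.< p
p-1<p p = <-by (2^->0 0) (solve 1 (λ p → p :- (p :- con 1ℚ) := con 1ℚ :- con 0ℚ) refl p)

-- Once the larger coordinates are placed, the new smallest one is subject to finitely many strict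
-- bounds, so it exists as soon as every lower bound is less than every upper bound. This
-- compatibility is what the closure of `J` under shrinking provides.
realise : ∀ n (J : Fin n → Fin n → Set) → (∀ p q → Dec (J p q)) →
  (∀ {a b p q} → a Fin.≤ p → p Fin.< q → q Fin.≤ b → J a b → J p q) →
  Σ[ y ∈ (Fin n → ℚ) ] (∀ p q → p Fin.< q →
    y p ℚ.< y q × (J p q → y q ℚ.< 1ℚ ℚ.+ y p) × (¬ J p q → 1ℚ ℚ.+ y p ℚ.< y q))
realise zero    J J? down = (λ ()) , λ ()
realise (suc n) J J? down = y , valid
  where
  rest = realise n (λ p q → J (suc p) (suc q)) (λ p q → J? (suc p) (suc q))
    (λ a≤p p<q q≤b → down (ℕ.s≤s a≤p) (ℕ.s≤s p<q) (ℕ.s≤s q≤b))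
  y′ = proj₁ rest

  upper : ∀ q → Dec (J zero (suc q)) → ℚ
  upper q (yes _) = y′ q
  upper q (no  _) = y′ q ℚ.- 1ℚ

  u : Fin n → ℚ
  u q = upper q (J? zero (suc q))

  M = proj₁ (upperBound (λ q → ℚ.- u q))

  below-u : ∀ q → ℚ.- M ℚ.- 1ℚ ℚ.< u q
  below-u q = ℚ.<-≤-trans (p-1<p (ℚ.- M)) (≤-by (proj₂ (proj₂ (upperBound (λ q → ℚ.- u q))) q)
    (solve 2 (λ m a → a :- (:- m) := m :- (:- a)) refl M (u q)))

  lower : ∀ q → Dec (J zero (suc q)) → ℚ
  lower q (yes _) = y′ q ℚ.- 1ℚ
  -- A far pair imposes no lower bound; this value is a dummy that lies under every upper bound.
  lower q (no  _) = ℚ.- M ℚ.- 1ℚ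

  -1-mono : ∀ {a b} → a ℚ.< b → a ℚ.- 1ℚ ℚ.< b ℚ.- 1ℚ
  -1-mono = ℚ.+-monoˡ-< (ℚ.- 1ℚ)

  <1+⇒-1< : ∀ {a b} → a ℚ.< 1ℚ ℚ.+ b → a ℚ.- 1ℚ ℚ.< b
  <1+⇒-1< {a} {b} h = <-by h (solve 2 (λ a b → b :- (a :- con 1ℚ) := (con 1ℚ :+ b) :- a) refl a b)

  -- A near pair `(0 , q)` makes both `(r , q)` and `(0 , r)` near for `r` below `q`; these are the
  -- two uses of `down`. The decisions are arguments so that they can be split on, and the equation
  -- ties `dr` back to `J?` for the dummy bound.
  lower<upper : ∀ q r (dq : Dec (J zero (suc q))) (dr : Dec (J zero (suc r))) →
                (∀ r → ℚ.- M ℚ.- 1ℚ ℚ.< upper r (J? zero (suc r))) → dr ≡ J? zero (suc r) →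
                lower q dq ℚ.< upper r dr
  lower<upper q r (no _) dr h refl = h r
  lower<upper q r (yes Jq) (yes Jr) _ _ with Fin.<-cmp r q
  ... | tri< r<q _ _  = <1+⇒-1< (proj₁ (proj₂ (proj₂ rest r q r<q))
    (down ℕ.z≤n (ℕ.s≤s r<q) ℕ.≤-refl Jq))
  ... | tri≈ _ refl _ = p-1<p (y′ q)
  ... | tri> _ _ q<r  = ℚ.<-trans (p-1<p (y′ q)) (proj₁ (proj₂ rest q r q<r))
  lower<upper q r (yes Jq) (no ¬Jr) _ _ with ℕ.<-≤-connex (Fin.toℕ q) (Fin.toℕ r)
  ... | inj₁ q<r = -1-mono (proj₁ (proj₂ rest q r q<r))
  ... | inj₂ r≤q = ⊥-elim (¬Jr (down ℕ.z≤n (ℕ.s≤s ℕ.z≤n) (ℕ.s≤s r≤q) Jq))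

  separated = between (λ q → lower q (J? zero (suc q))) u
    (λ q r → lower<upper q r (J? zero (suc q)) (J? zero (suc r)) below-u refl)

  y : Fin (suc n) → ℚ
  y zero    = proj₁ separated
  y (suc p) = y′ p

  -1<⇒<1+ : ∀ {a b} → a ℚ.- 1ℚ ℚ.< b → a ℚ.< 1ℚ ℚ.+ b
  -1<⇒<1+ {a} {b} h = <-by h (solve 2 (λ a b → (con 1ℚ :+ b) :- a := b :- (a :- con 1ℚ)) refl a b)

  <-1⇒1+< : ∀ {a b} → a ℚ.< b ℚ.- 1ℚ → 1ℚ ℚ.+ a ℚ.< b
  <-1⇒1+< {a} {b} h = <-by h (solve 2 (λ a b → b :- (con 1ℚ :+ a) := (b :- con 1ℚ) :- a) refl a b)

  valid₀ : ∀ q (d : Dec (J zero (suc q))) → lower q d ℚ.< y zero × y zero ℚ.< upper q d →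
    y zero ℚ.< y′ q × (J zero (suc q) → y′ q ℚ.< 1ℚ ℚ.+ y zero) ×
    (¬ J zero (suc q) → 1ℚ ℚ.+ y zero ℚ.< y′ q)
  valid₀ q (yes Jq) (l< , <u) = <u , (λ _ → -1<⇒<1+ l<) , λ ¬Jq → ⊥-elim (¬Jq Jq)
  valid₀ q (no ¬Jq) (l< , <u) =
    ℚ.<-trans <u (p-1<p (y′ q)) , (λ Jq → ⊥-elim (¬Jq Jq)) , λ _ → <-1⇒1+< <u

  valid : ∀ p q → p Fin.< q →
    y p ℚ.< y q × (J p q → y q ℚ.< 1ℚ ℚ.+ y p) × (¬ J p q → 1ℚ ℚ.+ y p ℚ.< y q)
  valid zero    (suc q) _           = valid₀ q (J? zero (suc q)) (proj₂ separated q)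
  valid (suc p) (suc q) (ℕ.s≤s p<q) = proj₂ rest p q p<q

-- With every pair near, the realised coordinates increase and spread over less than 1; negation
-- makes them decrease. An actual point is needed because an empty base region would lie vacuously
-- on both sides of every hyperplane.
basePoint : ∀ n → Σ[ x ∈ Point n ] BaseRegion x
basePoint n = x , (λ i j eq → gap⇒< (decreasing i j (ℕ.≤-reflexive (sym eq)))) ,
  λ i j i≡0 _ → gap⇒-1< (close i j i≡0)
  where
  r = realise n (λ _ _ → ⊤) (λ _ _ → yes tt) (λ _ _ _ _ → tt)
  y = proj₁ r
  x : Point n
  x i = fromℚ (ℚ.- y i)
  decreasing : ∀ i j → i Fin.< j → Gap 0ℚ (x i) (x j)
  decreasing i j i<j = fromℚ-gap (<-by (proj₁ (proj₂ r i j i<j))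
    (solve 2 (λ a b → (:- a) :- (con 0ℚ :+ (:- b)) := b :- a) refl (y i) (y j)))
  close : ∀ i j → Fin.toℕ i ≡ 0 → Gap (ℚ.- 1ℚ) (x j) (x i)
  close i j i≡0 with Fin.<-cmp i j
  ... | tri< i<j _ _  = fromℚ-gap (<-by (proj₁ (proj₂ (proj₂ r i j i<j)) tt)
    (solve 2 (λ a b → (:- b) :- ((:- con 1ℚ) :+ (:- a)) := (con 1ℚ :+ a) :- b) refl (y i) (y j)))
  ... | tri≈ _ refl _ = fromℚ-gap (<-by (2^->0 0)
    (solve 1 (λ a → (:- a) :- ((:- con 1ℚ) :+ (:- a)) := con 1ℚ :- con 0ℚ) refl (y i)))
  ... | tri> _ _ j<i  = ⊥-elim (ℕ.n≮0 (subst (Fin.toℕ j ℕ.<_) i≡0 j<i))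

-- Counting by a bijective relation

allPairs-lookup : {R : A → A → Set ℓ} {xs : List A} → AllPairs R xs →
  ∀ {i j} → i Fin.< j → R (List.lookup xs i) (List.lookup xs j)
allPairs-lookup (Rx ∷ _)  {zero}  {suc j} _           = All.lookup Rx (∈-lookup j)
allPairs-lookup (_ ∷ Rxs) {suc i} {suc j} (ℕ.s≤s i<j) = allPairs-lookup Rxs i<j

-- Injectivity of a relation, phrased for two entries so that `AllPairs` can carry it. It mentions
-- no equality on `A`, which suits regions, whose equality is that of a setoid.
Clash : (A → B → Set ℓ) → A → A → Set _
Clash R x x′ = ∀ y → R x y → ¬ R x′ y

-- Choosing a partner for each position gives a map between the index sets; a collision would be a
-- shared partner, so the map is injective.
length-≤ : {R : A → B → Set ℓ} {xs : List A} {ys : List B} →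
  (∀ {x} → x ∈ xs → ∃[ y ] (y ∈ ys × R x y)) → AllPairs (Clash R) xs →
  length xs ℕ.≤ length ys
length-≤ {R = R} {xs} {ys} total clash = Fin.injective⇒≤ f-injective
  where
  partner : ∀ i → ∃[ y ] (y ∈ ys × R (List.lookup xs i) y)
  partner i = total (∈-lookup i)

  f : Fin (length xs) → Fin (length ys)
  f i = index (proj₁ (proj₂ (partner i)))

  f-related : ∀ i → R (List.lookup xs i) (List.lookup ys (f i))
  f-related i = let _ , y∈ys , Rxy = partner i in
    subst (R (List.lookup xs i)) (Any.lookup-index y∈ys) Rxy

  f-injective : Injective _≡_ _≡_ f
  f-injective {i} {j} fi≡fj with Fin.<-cmp i j
  ... | tri< i<j _ _ = ⊥-elim (allPairs-lookup clash i<j _ (f-related i)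
    (subst (λ k → R (List.lookup xs j) (List.lookup ys k)) (sym fi≡fj) (f-related j)))
  ... | tri≈ _ i≡j _ = i≡j
  ... | tri> _ _ j<i = ⊥-elim (allPairs-lookup clash j<i _ (f-related j)
    (subst (λ k → R (List.lookup xs i) (List.lookup ys k)) fi≡fj (f-related i)))

length-≡ : {R : A → B → Set ℓ} {xs : List A} {ys : List B} →
  (∀ {x} → x ∈ xs → ∃[ y ] (y ∈ ys × R x y)) → AllPairs (Clash R) xs →
  (∀ {y} → y ∈ ys → ∃[ x ] (x ∈ xs × R x y)) → AllPairs (Clash (λ y x → R x y)) ys →
  length xs ≡ length ys
length-≡ total clash total′ clash′ = ℕ.≤-antisym (length-≤ total clash) (length-≤ total′ clash′)

unique-length-≡ : {xs ys : List A} → Unique xs → Unique ys →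
  (∀ {x} → x ∈ xs → x ∈ ys) → (∀ {x} → x ∈ ys → x ∈ xs) → length xs ≡ length ys
unique-length-≡ xs! ys! xs⊆ys ys⊆xs = length-≡ {R = _≡_}
  (λ x∈xs → _ , xs⊆ys x∈xs , refl) (AllPairs.map (λ { x≢x′ _ refl refl → x≢x′ refl }) xs!)
  (λ y∈ys → _ , ys⊆xs y∈ys , refl) (AllPairs.map (λ { y≢y′ _ refl refl → y≢y′ refl }) ys!)

length-filter-¬ : {P : Pred A p} (P? : Decidable P) (xs : List A) →
  length (filter P? xs) ℕ.+ length (filter (¬? ∘ P?) xs) ≡ length xs
length-filter-¬ P? []       = refl
length-filter-¬ P? (x ∷ xs) with P? x
... | yes _ = cong suc (length-filter-¬ P? xs)
... | no  _ = trans (ℕ.+-suc _ _) (cong suc (length-filter-¬ P? xs))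

-- Permutations, their inversions and subsets

-- If a value were missed, punching it out would give an injection into a set with one element
-- fewer.
injective⇒surjective : ∀ {n} {f : Fin n → Fin n} → Injective _≡_ _≡_ f → ∀ y → ∃[ x ] f x ≡ y
injective⇒surjective {suc n} {f} f-injective y with Fin.any? (λ x → f x Fin.≟ y)
... | yes found = found
... | no ¬found = ⊥-elim (ℕ.1+n≰n (Fin.injective⇒≤ punch-injective))
  where
  y≢f : ∀ x → y ≢ f x
  y≢f x y≡fx = ¬found (x , sym y≡fx)
  punch-injective : Injective _≡_ _≡_ (λ x → Fin.punchOut (y≢f x))
  punch-injective eq = f-injective (Fin.punchOut-injective (y≢f _) (y≢f _) eq)

∈-words : ∀ {m n} (v : Vec (Fin m) n) → v ∈ words m n
∈-words Vec.[]      = here refl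
∈-words (x Vec.∷ v) = ∈-cartesianProductWith⁺ Vec._∷_ (∈-allFin x) (∈-words v)

words-unique : ∀ m n → Unique (words m n)
words-unique m zero    = [] ∷ []
words-unique m (suc n) = Unique.cartesianProductWith⁺ Vec._∷_ Vec.∷-injective
  (Unique.allFin⁺ m) (words-unique m n)

distinct⇒injective : {v : Vec A n} → VecAllPairs.AllPairs _≢_ v → Injective _≡_ _≡_ (lookup v)
distinct⇒injective (x∉v VecAllPairs.∷ v!) {zero}  {zero}  _  = refl
distinct⇒injective (x∉v VecAllPairs.∷ v!) {zero}  {suc j} eq = ⊥-elim (VecAll.lookup⁺ x∉v j eq)
distinct⇒injective (x∉v VecAllPairs.∷ v!) {suc i} {zero}  eq = ⊥-elim (VecAll.lookup⁺ x∉v i (sym eq))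
distinct⇒injective (x∉v VecAllPairs.∷ v!) {suc i} {suc j} eq = cong suc (distinct⇒injective v! eq)

injective⇒distinct : {v : Vec A n} → Injective _≡_ _≡_ (lookup v) → VecAllPairs.AllPairs _≢_ v
injective⇒distinct {v = Vec.[]}    inj = VecAllPairs.[]
injective⇒distinct {v = x Vec.∷ v} inj =
  VecAll.lookup⁻ (λ j eq → Fin.0≢1+n (inj {zero} {suc j} eq)) VecAllPairs.∷
  injective⇒distinct (λ eq → Fin.suc-injective (inj eq))

∈-permutations⁺ : {π : Vec (Fin n) n} → Injective _≡_ _≡_ (lookup π) → π ∈ permutations n
∈-permutations⁺ {π = π} inj = ∈-filter⁺ _ (∈-words π) (injective⇒distinct inj)

∈-permutations⁻ : {π : Vec (Fin n) n} → π ∈ permutations n → Injective _≡_ _≡_ (lookup π)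
∈-permutations⁻ {n} π∈ = distinct⇒injective (proj₂ (∈-filter⁻ _ {xs = words n n} π∈))

permutations-unique : ∀ n → Unique (permutations n)
permutations-unique n = Unique.filter⁺ _ (words-unique n n)

lookup-injective : {v w : Vec A n} → (∀ i → lookup v i ≡ lookup w i) → v ≡ w
lookup-injective {v = v} {w} eq =
  trans (sym (Vec.tabulate∘lookup v)) (trans (Vec.tabulate-cong eq) (Vec.tabulate∘lookup w))

pairs-unique : ∀ n → Unique (pairs n)
pairs-unique n = Unique.cartesianProduct⁺ (Unique.allFin⁺ n) (Unique.allFin⁺ n)

∈-pairs : (g : Fin n × Fin n) → g ∈ pairs n
∈-pairs (i , j) = ∈-cartesianProduct⁺ (∈-allFin i) (∈-allFin j)

module _ (π : Vec (Fin n) n) where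

  ∈-inversions⁺ : ∀ {g} → Inversion π g → g ∈ inversions π
  ∈-inversions⁺ {g} inv = ∈-filter⁺ (inversion? π) (∈-pairs g) inv

  ∈-inversions⁻ : ∀ {g} → g ∈ inversions π → Inversion π g
  ∈-inversions⁻ g∈ = proj₂ (∈-filter⁻ (inversion? π) {xs = pairs n} g∈)

  ∈-nonInversions⁺ : ∀ {g} → NonInversion π g → g ∈ nonInversions π
  ∈-nonInversions⁺ {g} inv = ∈-filter⁺ (nonInversion? π) (∈-pairs g) inv

  ∈-nonInversions⁻ : ∀ {g} → g ∈ nonInversions π → NonInversion π g
  ∈-nonInversions⁻ g∈ = proj₂ (∈-filter⁻ (nonInversion? π) {xs = pairs n} g∈)

  inversions-unique : Unique (inversions π)
  inversions-unique = Unique.filter⁺ (inversion? π) (pairs-unique n)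

  nonInversions-unique : Unique (nonInversions π)
  nonInversions-unique = Unique.filter⁺ (nonInversion? π) (pairs-unique n)

-- The recursion separates the pairs that start at `zero` from the rest and thus follows Pascal's
-- rule, which makes the length a binomial coefficient.
increasingPairs : ∀ n → List (Fin n × Fin n)
increasingPairs zero    = []
increasingPairs (suc n) =
  map (λ j → zero , suc j) (allFin n) ++ map (λ (i , j) → suc i , suc j) (increasingPairs n)

length-increasingPairs : ∀ n → length (increasingPairs n) ≡ n choose 2
length-increasingPairs zero    = refl
length-increasingPairs (suc n) = begin
  length (increasingPairs (suc n))
    ≡⟨ List.length-++ (map (λ j → zero , suc j) (allFin n)) ⟩
  length (map (λ j → Fin.zero {n} , suc j) (allFin n)) ℕ.+
  length (map (λ (i , j) → suc i , suc j) (increasingPairs n))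
    ≡⟨ cong₂ ℕ._+_ (trans (List.length-map _ (allFin n)) (List.length-tabulate {n = n} (λ i → i)))
                   (trans (List.length-map _ (increasingPairs n)) (length-increasingPairs n)) ⟩
  n ℕ.+ n choose 2
    ≡⟨ cong (ℕ._+ n choose 2) (nC1≡n n) ⟨
  n choose 1 ℕ.+ n choose 2
    ≡⟨ nCk+nC[k+1]≡[n+1]C[k+1] n 1 ⟩
  suc n choose 2 ∎
  where open ≡-Reasoning

∈-increasingPairs⁺ : ∀ {n} {i j : Fin n} → i Fin.< j → (i , j) ∈ increasingPairs n
∈-increasingPairs⁺ {i = zero}  {suc j} _ = ∈-++⁺ˡ (∈-map⁺ _ (∈-allFin j))
∈-increasingPairs⁺ {suc n} {i = suc i} {suc j} (ℕ.s≤s i<j) =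
  ∈-++⁺ʳ (map (λ j → zero , suc j) (allFin n)) (∈-map⁺ _ (∈-increasingPairs⁺ i<j))

∈-increasingPairs⁻ : ∀ {n} {g : Fin n × Fin n} → g ∈ increasingPairs n → proj₁ g Fin.< proj₂ g
∈-increasingPairs⁻ {suc n} g∈ with ∈-++⁻ (map (λ j → zero , suc j) (allFin n)) g∈
... | inj₁ g∈₀ with ∈-map⁻ _ g∈₀
...   | _ , _ , refl = ℕ.s≤s ℕ.z≤n
∈-increasingPairs⁻ {suc n} g∈ | inj₂ g∈₁ with ∈-map⁻ _ g∈₁
...   | _ , g′∈ , refl = ℕ.s≤s (∈-increasingPairs⁻ g′∈)

increasingPairs-unique : ∀ n → Unique (increasingPairs n)
increasingPairs-unique zero    = []
increasingPairs-unique (suc n) = Unique.++⁺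
  (Unique.map⁺ (λ { refl → refl }) (Unique.allFin⁺ n))
  (Unique.map⁺ (λ { refl → refl }) (increasingPairs-unique n))
  λ { (g∈₀ , g∈₁) → disjoint (∈-map⁻ _ g∈₀) (∈-map⁻ _ g∈₁) }
  where
  disjoint : ∀ {g} → ∃[ j ] (j ∈ allFin n × g ≡ (zero , suc j)) →
    ∃[ h ] (h ∈ increasingPairs n × g ≡ (suc (proj₁ h) , suc (proj₂ h))) → ⊥
  disjoint (_ , _ , refl) (_ , _ , ())

length-inversions : (π : Vec (Fin n) n) → Injective _≡_ _≡_ (lookup π) →
  length (nonInversions π) ℕ.+ length (inversions π) ≡ n choose 2
length-inversions {n} π inj = begin
  length (nonInversions π) ℕ.+ length (inversions π)
    ≡⟨ List.length-++ (nonInversions π) ⟨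
  length (nonInversions π ++ inversions π)
    ≡⟨ unique-length-≡
         (Unique.++⁺ (nonInversions-unique π) (inversions-unique π) λ (g∈ , g∈′) →
           ℕ.<-asym (proj₂ (∈-nonInversions⁻ π g∈)) (proj₂ (∈-inversions⁻ π g∈′)))
         (increasingPairs-unique n) ⊆ ⊇ ⟩
  length (increasingPairs n)
    ≡⟨ length-increasingPairs n ⟩
  n choose 2 ∎
  where
  open ≡-Reasoning
  ⊆ : ∀ {g} → g ∈ nonInversions π ++ inversions π → g ∈ increasingPairs n
  ⊆ g∈ with ∈-++⁻ (nonInversions π) g∈
  ... | inj₁ g∈N = ∈-increasingPairs⁺ (proj₁ (∈-nonInversions⁻ π g∈N))
  ... | inj₂ g∈I = ∈-increasingPairs⁺ (proj₁ (∈-inversions⁻ π g∈I))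
  ⊇ : ∀ {g} → g ∈ increasingPairs n → g ∈ nonInversions π ++ inversions π
  ⊇ {i , j} g∈ with ∈-increasingPairs⁻ g∈ | Fin.<-cmp (lookup π i) (lookup π j)
  ... | i<j | tri< lt _ _ = ∈-++⁺ˡ (∈-nonInversions⁺ π (i<j , lt))
  ... | i<j | tri≈ _ eq _ = ⊥-elim (Fin.<⇒≢ i<j (inj eq))
  ... | i<j | tri> _ _ gt = ∈-++⁺ʳ (nonInversions π) (∈-inversions⁺ π (i<j , gt))

∈-subsets⇒⊆ : (xs : List A) {I : List A} → I ∈ subsets xs → ∀ {y} → y ∈ I → y ∈ xs
∈-subsets⇒⊆ []       (here refl) ()
∈-subsets⇒⊆ (x ∷ xs) I∈ y∈I with ∈-++⁻ (subsets xs) I∈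
... | inj₁ I∈′ = there (∈-subsets⇒⊆ xs I∈′ y∈I)
... | inj₂ I∈′ with ∈-map⁻ (x ∷_) I∈′
...   | J , J∈ , refl with y∈I
...     | here y≡x  = here y≡x
...     | there y∈J = there (∈-subsets⇒⊆ xs J∈ y∈J)

∈-subsets⇒unique : {xs : List A} → Unique xs → ∀ {I} → I ∈ subsets xs → Unique I
∈-subsets⇒unique [] (here refl) = []
∈-subsets⇒unique {xs = x ∷ xs} (x∉xs ∷ xs!) I∈ with ∈-++⁻ (subsets xs) I∈
... | inj₁ I∈′ = ∈-subsets⇒unique xs! I∈′
... | inj₂ I∈′ with ∈-map⁻ (x ∷_) I∈′
...   | J , J∈ , refl = All.tabulate (λ y∈J → All.lookup x∉xs (∈-subsets⇒⊆ xs J∈ y∈J))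
                        ∷ ∈-subsets⇒unique xs! J∈

filter∈subsets : {P : Pred A p} (P? : Decidable P) (xs : List A) → filter P? xs ∈ subsets xs
filter∈subsets P? []       = here refl
filter∈subsets P? (x ∷ xs) with P? x
... | yes _ = ∈-++⁺ʳ (subsets xs) (∈-map⁺ (x ∷_) (filter∈subsets P? xs))
... | no  _ = ∈-++⁺ˡ (filter∈subsets P? xs)

-- Inequality of lists would be too weak: the witness `y` becomes the inversion at whose hyperplane
-- two codes make contradictory demands.
DifferWithin : List A → List A → List A → Set
DifferWithin xs I J = ∃[ y ] (y ∈ xs × ((y ∈ I × y ∉ J) ⊎ (y ∉ I × y ∈ J)))

subsets-differ : {xs : List A} → Unique xs → AllPairs (DifferWithin xs) (subsets xs)
subsets-differ [] = [] ∷ []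
subsets-differ {xs = x ∷ xs} (x≢xs ∷ xs!) = AllPairs.++⁺
  (AllPairs.map (λ (y , y∈xs , differ) → y , there y∈xs , differ) (subsets-differ xs!))
  (AllPairs.map⁺ (AllPairs.map cons (subsets-differ xs!)))
  (All.tabulate λ I∈ → All.map⁺ (All.tabulate λ _ →
    x , here refl , inj₂ ((λ x∈I → x∉xs (∈-subsets⇒⊆ xs I∈ x∈I)) , here refl)))
  where
  x∉xs : x ∉ xs
  x∉xs x∈xs = All.lookup x≢xs x∈xs refl
  skip : ∀ {y J} → y ∈ xs → y ∉ J → y ∉ x ∷ J
  skip y∈xs y∉J (here refl) = x∉xs y∈xs
  skip y∈xs y∉J (there y∈J) = y∉J y∈J
  cons : ∀ {I J} → DifferWithin xs I J → DifferWithin (x ∷ xs) (x ∷ I) (x ∷ J)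
  cons (y , y∈xs , inj₁ (y∈I , y∉J)) = y , there y∈xs , inj₁ (there y∈I , skip y∈xs y∉J)
  cons (y , y∈xs , inj₂ (y∉I , y∈J)) = y , there y∈xs , inj₂ (skip y∈xs y∉I , there y∈J)

-- Sorting the coordinates of a point

Increasing : Point n → Vec (Fin n) n → Set
Increasing x π = ∀ {p q} → p Fin.< q → Gap 0ℚ (x (lookup π q)) (x (lookup π p))

increasing⇒injective : {x : Point n} {π : Vec (Fin n) n} → Increasing x π →
                       Injective _≡_ _≡_ (lookup π)
increasing⇒injective {x = x} {π} inc {p} {q} eq with Fin.<-cmp p q
... | tri< p<q _ _ = ⊥-elim (gap-irrefl ℚ.≤-refl
  (subst (λ i → Gap 0ℚ (x i) (x (lookup π p))) (sym eq) (inc p<q)))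
... | tri≈ _ p≡q _ = p≡q
... | tri> _ _ q<p = ⊥-elim (gap-irrefl ℚ.≤-refl
  (subst (λ i → Gap 0ℚ (x i) (x (lookup π q))) eq (inc q<p)))

increasing-reflects-< : (x : Point n) (π : Vec (Fin n) n) → Increasing x π → ∀ {p q} →
                        Gap 0ℚ (x (lookup π q)) (x (lookup π p)) → p Fin.< q
increasing-reflects-< x π inc {p} {q} g with Fin.<-cmp p q
... | tri< p<q _ _  = p<q
... | tri≈ _ refl _ = ⊥-elim (gap-irrefl ℚ.≤-refl g)
... | tri> _ _ q<p  = ⊥-elim (gap-asym g (inc q<p))

-- Each step to the next position raises the value by at least one, starting from at least 0.
monotone⇒≤ : {f : Fin n → Fin n} → (∀ {p q} → p Fin.< q → f p Fin.< f q) → ∀ p → p Fin.≤ f p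
monotone⇒≤ {n} {f} mono p = go (Fin.toℕ p) p refl
  where
  go : ∀ k p → Fin.toℕ p ≡ k → k ℕ.≤ Fin.toℕ (f p)
  go zero    p eq = ℕ.z≤n
  go (suc k) p eq = ℕ.≤-<-trans (go k p′ toℕ-p′) (mono (subst₂ ℕ._<_ (sym toℕ-p′) (sym eq) ℕ.≤-refl))
    where
    k<n : k ℕ.< n
    k<n = ℕ.<-trans (subst (k ℕ.<_) (sym eq) ℕ.≤-refl) (Fin.toℕ<n p)
    p′ = Fin.fromℕ< k<n
    toℕ-p′ : Fin.toℕ p′ ≡ k
    toℕ-p′ = Fin.toℕ-fromℕ< k<n

-- The map matching the positions of equal entries is strictly increasing, and so
-- is its inverse; both are therefore ≥ the identity.
increasing-unique : (x : Point n) (π ρ : Vec (Fin n) n) → Increasing x π → Increasing x ρ → π ≡ ρ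
increasing-unique x π ρ π↗ ρ↗ = lookup-injective λ p →
  trans (sym (φ-eq p)) (cong (lookup ρ) (Fin.≤-antisym (φ≤ p) (monotone⇒≤ φ-mono p)))
  where
  match : ∀ (σ τ : Vec _ _) → Increasing x τ → ∀ p → ∃[ q ] lookup τ q ≡ lookup σ p
  match σ τ τ↗ p = injective⇒surjective (increasing⇒injective {x = x} {τ} τ↗) (lookup σ p)

  match-mono : ∀ σ τ → Increasing x σ → (τ↗ : Increasing x τ) → ∀ {p q} → p Fin.< q →
    proj₁ (match σ τ τ↗ p) Fin.< proj₁ (match σ τ τ↗ q)
  match-mono σ τ σ↗ τ↗ {p} {q} p<q = increasing-reflects-< x τ τ↗
    (subst₂ (λ i j → Gap 0ℚ (x i) (x j))
      (sym (proj₂ (match σ τ τ↗ q))) (sym (proj₂ (match σ τ τ↗ p))) (σ↗ p<q))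

  φ ψ : Fin _ → Fin _
  φ p = proj₁ (match π ρ ρ↗ p)
  ψ p = proj₁ (match ρ π π↗ p)

  φ-eq : ∀ p → lookup ρ (φ p) ≡ lookup π p
  φ-eq p = proj₂ (match π ρ ρ↗ p)

  φ-mono : ∀ {p q} → p Fin.< q → φ p Fin.< φ q
  φ-mono = match-mono π ρ π↗ ρ↗

  ψφ : ∀ p → ψ (φ p) ≡ p
  ψφ p = increasing⇒injective {x = x} {π} π↗ (trans (proj₂ (match ρ π π↗ (φ p))) (φ-eq p))

  φ≤ : ∀ p → φ p Fin.≤ p
  φ≤ p = subst (φ p Fin.≤_) (ψφ p) (monotone⇒≤ (match-mono ρ π ρ↗ π↗) (φ p))

compareCoordinates : (x : Point n) → ShiComplement x → ∀ i j → i ≢ j →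
                     Gap 0ℚ (x j) (x i) ⊎ Gap 0ℚ (x i) (x j)
compareCoordinates x Sx i j i≢j with Fin.<-cmp i j
... | tri< i<j _ _ = Sum.map (below⇒gap {0ℚ} {x i} {x j}) gap (proj₁ (Sx i j i<j))
... | tri≈ _ i≡j _ = ⊥-elim (i≢j i≡j)
... | tri> _ _ j<i = Sum.swap (Sum.map (below⇒gap {0ℚ} {x j} {x i}) gap (proj₁ (Sx j i j<i)))

allPairs-toList : {R : A → A → Set ℓ} (v : Vec A n) → AllPairs R (Vec.toList v) →
                  ∀ {p q} → p Fin.< q → R (lookup v p) (lookup v q)
allPairs-toList (x Vec.∷ v) (Rx ∷ _)  {zero}  {suc q} _           = all-toList v Rx q
  where
  all-toList : ∀ {P : Pred A ℓ} {n} (v : Vec A n) → All P (Vec.toList v) → ∀ q → P (lookup v q)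
  all-toList (y Vec.∷ v) (py ∷ pv) zero    = py
  all-toList (y Vec.∷ v) (py ∷ pv) (suc q) = all-toList v pv q
allPairs-toList (x Vec.∷ v) (_ ∷ Rxs) {suc p} {suc q} (ℕ.s≤s p<q) = allPairs-toList v Rxs p<q

sortCoordinates : (x : Point n) → ShiComplement x → ∃[ π ] Increasing x π
sortCoordinates {n} x Sx = π , allPairs-toList π
  (subst (AllPairs (λ i j → Gap 0ℚ (x j) (x i))) (sym (proj₂ (asVec (sort (allFin n)) length-sorted))) sorted↗)
  where
  _≺_ : Fin n → Fin n → Set
  i ≺ j = Gap 0ℚ (x j) (x i)

  compare : ∀ i j → Tri (i ≺ j) (i ≡ j) (j ≺ i)
  compare i j with i Fin.≟ j
  ... | yes refl = tri≈ (gap-irrefl ℚ.≤-refl) refl (gap-irrefl ℚ.≤-refl)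
  ... | no i≢j with compareCoordinates x Sx i j i≢j
  ...   | inj₁ i≺j = tri< i≺j i≢j (gap-asym i≺j)
  ...   | inj₂ j≺i = tri> (gap-asym j≺i) i≢j j≺i

  order : StrictTotalOrder _ _ _
  order = record
    { Carrier = Fin n ; _≈_ = _≡_ ; _<_ = _≺_
    ; isStrictTotalOrder = record
      { isStrictPartialOrder = record
        { isEquivalence = isEquivalence
        ; irrefl = λ { refl → gap-irrefl ℚ.≤-refl }
        ; trans = λ i≺j j≺k → gap-trans {0ℚ} {0ℚ} j≺k i≺j
        ; <-resp-≈ = (λ { refl g → g }) , (λ { refl g → g }) }
      ; compare = compare } }

  open StrictTotalOrderProperties order using (decTotalOrder)
  open Sort decTotalOrder using (sort; sort-↭; sort-↗)

  asVec : ∀ (xs : List (Fin n)) {m} → length xs ≡ m → ∃[ v ] Vec.toList {n = m} v ≡ xs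
  asVec xs refl = Vec.fromList xs , Vec.toList∘fromList xs

  length-sorted : length (sort (allFin n)) ≡ n
  length-sorted = trans (↭-length (sort-↭ (allFin n))) (List.length-tabulate {n = n} (λ i → i))

  π : Vec (Fin n) n
  π = proj₁ (asVec (sort (allFin n)) length-sorted)

  -- Sorting yields `≺` or equality for each pair; the entries remain distinct under the
  -- permutation, which excludes equality.
  sorted↗ : AllPairs _≺_ (sort (allFin n))
  sorted↗ = AllPairs.zipWith (λ { (inj₁ i≺j , _) → i≺j ; (inj₂ i≡j , i≢j) → ⊥-elim (i≢j i≡j) })
    (Sorted.Sorted⇒AllPairs totalOrder (sort-↗ (allFin n)) ,
     PermSetoid.Unique-resp-↭ (setoid (Fin n)) (↭⇒↭ₛ (↭-sym (sort-↭ (allFin n)))) (Unique.allFin⁺ n))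
    where open DecTotalOrder decTotalOrder using (totalOrder)

-- Codes of regions

Code : ℕ → Set
Code n = Vec (Fin n) n × List (Fin n × Fin n)

-- π lists the coordinates in increasing order; an inversion lies in I when
-- the corresponding difference of coordinates is less than 1.
record Encodes (c : Code n) (x : Point n) : Set where
  constructor encodes
  private
    π = proj₁ c
    I = proj₂ c
  field
    increasing : Increasing x π
    inside     : ∀ {p q} → Inversion π (p , q) → (p , q) ∈ I →
                 Below 1ℝ (lookup π q) (lookup π p) x
    outside    : ∀ {p q} → Inversion π (p , q) → (p , q) ∉ I →
                 Above 1ℝ (lookup π q) (lookup π p) x

open Encodes

_∈?_ : (g : Fin n × Fin n) (I : List (Fin n × Fin n)) → Dec (g ∈ I)
_∈?_ = DecMembership._∈?_ (≡-dec Fin._≟_ Fin._≟_)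

-- The permutation is forced by the order of the coordinates. An inversion belonging to only one of
-- `I` and `J` would place `x` on both sides of one hyperplane.
encodes-clash : {π ρ : Vec (Fin n) n} {I J : List (Fin n × Fin n)} {x : Point n} →
  Encodes (π , I) x → Encodes (ρ , J) x → π ≡ ρ × ¬ DifferWithin (inversions π) I J
encodes-clash {π = π} {ρ} {I} {J} {x} e f
  with increasing-unique x π ρ (increasing e) (increasing f)
... | refl = refl , clash
  where
  clash : ¬ DifferWithin (inversions π) I J
  clash ((p , q) , g∈ , inj₁ (g∈I , g∉J)) = above⇒¬below x 1ℚ (lookup π q) (lookup π p)
    (outside f (∈-inversions⁻ π g∈) g∉J) (inside e (∈-inversions⁻ π g∈) g∈I)
  clash ((p , q) , g∈ , inj₂ (g∉I , g∈J)) = above⇒¬below x 1ℚ (lookup π q) (lookup π p)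
    (outside e (∈-inversions⁻ π g∈) g∉I) (inside f (∈-inversions⁻ π g∈) g∈J)

-1≤0 : ℚ.- 1ℚ ℚ.≤ 0ℚ
-1≤0 = ℚ.nonPositive⁻¹ (ℚ.- 1ℚ)

-- The three possible places of `x_i - x_j` for `i < j`: below 0, between 0 and 1, above 1. Values
-- are linked to positions by equations, so that matching on `refl` replaces `i` and `j` by entries
-- of the permutation.
data Position (c : Code n) (i j : Fin n) : Set where
  before : ∀ {p q} → p Fin.< q → lookup (proj₁ c) p ≡ i → lookup (proj₁ c) q ≡ j → Position c i j
  near   : ∀ {p q} → Inversion (proj₁ c) (p , q) → (p , q) ∈ proj₂ c →
           lookup (proj₁ c) q ≡ i → lookup (proj₁ c) p ≡ j → Position c i j
  far    : ∀ {p q} → Inversion (proj₁ c) (p , q) → (p , q) ∉ proj₂ c →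
           lookup (proj₁ c) q ≡ i → lookup (proj₁ c) p ≡ j → Position c i j

position : (c : Code n) → Injective _≡_ _≡_ (lookup (proj₁ c)) → ∀ {i j} → i Fin.< j → Position c i j
position (π , I) inj {i} {j} i<j
  with p , refl ← injective⇒surjective inj i
  with q , refl ← injective⇒surjective inj j
  with Fin.<-cmp p q
... | tri< p<q _ _  = before p<q refl refl
... | tri≈ _ refl _ = ⊥-elim (ℕ.<-irrefl refl i<j)
... | tri> _ _ q<p with (q , p) ∈? I
...   | yes g∈I = near (q<p , i<j) g∈I refl refl
...   | no  g∉I = far (q<p , i<j) g∉I refl refl

module _ {c : Code n} {x : Point n} (e : Encodes c x) where

  private
    π = proj₁ c

  inversion-above : ∀ {p q} → Inversion π (p , q) → Above 0ℝ (lookup π q) (lookup π p) x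
  inversion-above (p<q , _) = ungap (increasing e p<q)

  before-below₀ : ∀ {p q} → p Fin.< q → Below 0ℝ (lookup π p) (lookup π q) x
  before-below₀ {p} {q} p<q = gap⇒below {0ℚ} {x (lookup π p)} {x (lookup π q)} (increasing e p<q)

  before-below₁ : ∀ {p q} → p Fin.< q → Below 1ℝ (lookup π p) (lookup π q) x
  before-below₁ {p} {q} p<q =
    gap⇒below {1ℚ} {x (lookup π p)} {x (lookup π q)} (gap-≤ -1≤0 (increasing e p<q))

encodes⇒agree : {c : Code n} {x y : Point n} → Encodes c x → Encodes c y → Agree x y
encodes⇒agree {c = c} {x} {y} e f i j i<j
  with position c (increasing⇒injective {x = x} {proj₁ c} (increasing e)) i<j
... | before p<q refl refl =
  ((λ a → ⊥-elim (above⇒¬below x 0ℚ _ _ a (before-below₀ e p<q))) , (λ _ → before-below₀ f p<q)) ,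
  ((λ a → ⊥-elim (above⇒¬below x 1ℚ _ _ a (before-below₁ e p<q))) , (λ _ → before-below₁ f p<q))
... | near inv g∈I refl refl =
  ((λ _ → inversion-above f inv) , (λ b → ⊥-elim (above⇒¬below x 0ℚ _ _ (inversion-above e inv) b))) ,
  ((λ a → ⊥-elim (above⇒¬below x 1ℚ _ _ a (inside e inv g∈I))) , (λ _ → inside f inv g∈I))
... | far inv g∉I refl refl =
  ((λ _ → inversion-above f inv) , (λ b → ⊥-elim (above⇒¬below x 0ℚ _ _ (inversion-above e inv) b))) ,
  ((λ _ → outside f inv g∉I) , (λ b → ⊥-elim (above⇒¬below x 1ℚ _ _ (outside e inv g∉I) b)))

encodes-resp : {c : Code n} {x y : Point n} → Agree x y → Encodes c x → Encodes c y
encodes-resp {c = π , I} {x} {y} x~y e = encodes increasing′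
  (λ {p} {q} inv g∈I → proj₂ (proj₂ (x~y (lookup π q) (lookup π p) (proj₂ inv))) (inside e inv g∈I))
  (λ {p} {q} inv g∉I → proj₁ (proj₂ (x~y (lookup π q) (lookup π p) (proj₂ inv))) (outside e inv g∉I))
  where
  increasing′ : Increasing y π
  increasing′ {p} {q} p<q with Fin.<-cmp (lookup π p) (lookup π q)
  ... | tri< i<j _ _ = below⇒gap {0ℚ} {y (lookup π p)} {y (lookup π q)}
    (proj₂ (proj₁ (x~y (lookup π p) (lookup π q) i<j)) (before-below₀ e p<q))
  ... | tri≈ _ i≡j _ = ⊥-elim (Fin.<⇒≢ p<q (increasing⇒injective {x = x} {π} (increasing e) i≡j))
  ... | tri> _ _ j<i = gap (proj₁ (proj₁ (x~y (lookup π q) (lookup π p) j<i)) (ungap (increasing e p<q)))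

-- Passing between points and codes

encode : (x : Point n) → ShiComplement x →
  ∃[ π ] ∃[ I ] (π ∈ permutations n × I ∈ ideals π × Encodes (π , I) x)
encode {n} x Sx = π , I , ∈-permutations⁺ (increasing⇒injective {x = x} {π} π↗) ,
  ∈-filter⁺ (isIdeal? π) (filter∈subsets close? (inversions π)) ideal ,
  encodes π↗ (λ _ g∈I → proj₂ (I⇒close g∈I)) far-outside
  where
  π = proj₁ (sortCoordinates x Sx)

  π↗ : Increasing x π
  π↗ = proj₂ (sortCoordinates x Sx)

  Close : Fin n × Fin n → Set
  Close (p , q) = Inversion π (p , q) × Below 1ℝ (lookup π q) (lookup π p) x

  close? : Decidable Close
  close? (p , q) with inversion? π (p , q)
  ... | no ¬inv = no λ close → ¬inv (proj₁ close)
  ... | yes inv with proj₂ (Sx (lookup π q) (lookup π p) (proj₂ inv))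
  ...   | inj₁ below = yes (inv , below)
  ...   | inj₂ above = no λ close → above⇒¬below x 1ℚ _ _ above (proj₂ close)

  I = filter close? (inversions π)

  I⇒close : ∀ {g} → g ∈ I → Close g
  I⇒close g∈I = proj₂ (∈-filter⁻ close? {xs = inversions π} g∈I)

  close⇒I : ∀ {g} → Close g → g ∈ I
  close⇒I close = ∈-filter⁺ close? (∈-inversions⁺ π (proj₁ close)) close

  far-outside : ∀ {p q} → Inversion π (p , q) → (p , q) ∉ I → Above 1ℝ (lookup π q) (lookup π p) x
  far-outside {p} {q} inv g∉I with proj₂ (Sx (lookup π q) (lookup π p) (proj₂ inv))
  ... | inj₁ below = ⊥-elim (g∉I (close⇒I (inv , below)))
  ... | inj₂ above = above

  -- Raising the lower position or lowering the upper one decreases the difference of the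
  -- coordinates, so closeness passes to contained pairs. This is the ideal property of `I`.
  shrinkˡ : ∀ {a i v} → a Fin.≤ i → Gap (ℚ.- 1ℚ) (x (lookup π a)) v → Gap (ℚ.- 1ℚ) (x (lookup π i)) v
  shrinkˡ {a} {i} a≤i g with Fin.<-cmp a i
  ... | tri< a<i _ _  = gap-trans {0ℚ} {ℚ.- 1ℚ} (π↗ a<i) g
  ... | tri≈ _ refl _ = g
  ... | tri> _ _ i<a  = ⊥-elim (ℕ.<⇒≱ i<a a≤i)

  shrinkʳ : ∀ {j b u} → j Fin.≤ b → Gap (ℚ.- 1ℚ) u (x (lookup π b)) → Gap (ℚ.- 1ℚ) u (x (lookup π j))
  shrinkʳ {j} {b} j≤b g with Fin.<-cmp j b
  ... | tri< j<b _ _  = gap-trans {ℚ.- 1ℚ} {0ℚ} g (π↗ j<b)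
  ... | tri≈ _ refl _ = g
  ... | tri> _ _ b<j  = ⊥-elim (ℕ.<⇒≱ b<j j≤b)

  ideal : IsIdeal π I
  ideal = All.tabulate λ {(a , b)} h∈I → All.tabulate λ {(i , j)} g∈ (a≤i , j≤b) →
    close⇒I (∈-inversions⁻ π g∈ , gap⇒below {1ℚ} {x (lookup π j)} {x (lookup π i)}
      (shrinkˡ a≤i (shrinkʳ j≤b
        (below⇒gap {1ℚ} {x (lookup π b)} {x (lookup π a)} (proj₂ (I⇒close h∈I))))))

decode : {π : Vec (Fin n) n} {I : List (Fin n × Fin n)} →
  π ∈ permutations n → I ∈ ideals π → Σ[ R ∈ Region n ] Encodes (π , I) (proj₁ R)
decode {n} {π} {I} π∈ I∈ = (x , Sx) , code
  where
  inj : Injective _≡_ _≡_ (lookup π)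
  inj = ∈-permutations⁻ π∈

  -- `I` consists of inversions only, whereas `realise` needs a condition on all pairs of positions
  -- that is closed under shrinking.
  J : Fin n → Fin n → Set
  J p q = Any ((p , q) ≼_) I

  J? : ∀ p q → Dec (J p q)
  J? p q = Any.any? ((p , q) ≼?_) I

  -- Restricted to inversions, the generated down-set is `I` again, precisely because `I` is an
  -- ideal.
  J-ideal : ∀ {p q} → Inversion π (p , q) → J p q → (p , q) ∈ I
  J-ideal inv Jpq with find Jpq
  ... | h , h∈I , g≼h = All.lookup (All.lookup (proj₂ (∈-filter⁻ (isIdeal? π) {xs = subsets (inversions π)} I∈)) h∈I)
                          (∈-inversions⁺ π inv) g≼h

  realisation = realise n J J? λ a≤p _ q≤b → Any.map λ (a′≤a , b≤b′) →
    ℕ.≤-trans a′≤a a≤p , ℕ.≤-trans q≤b b≤b′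
  y = proj₁ realisation

  π⁻¹ : Fin n → Fin n
  π⁻¹ i = proj₁ (injective⇒surjective inj i)

  ππ⁻¹ : ∀ i → lookup π (π⁻¹ i) ≡ i
  ππ⁻¹ i = proj₂ (injective⇒surjective inj i)

  π⁻¹π : ∀ p → π⁻¹ (lookup π p) ≡ p
  π⁻¹π p = inj (ππ⁻¹ (lookup π p))

  x : Point n
  x i = fromℚ (y (π⁻¹ i))

  y-increasing : ∀ {p q} → p Fin.< q → Gap 0ℚ (fromℚ (y q)) (fromℚ (y p))
  y-increasing {p} {q} p<q = fromℚ-gap
    (subst (ℚ._< y q) (sym (ℚ.+-identityˡ (y p))) (proj₁ (proj₂ realisation p q p<q)))

  y-near : ∀ {p q} → p Fin.< q → J p q → Gap (ℚ.- 1ℚ) (fromℚ (y p)) (fromℚ (y q))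
  y-near {p} {q} p<q Jpq = fromℚ-gap (subst₂ ℚ._<_
    (ℚ.+-comm (y q) (ℚ.- 1ℚ))
    (solve 1 (λ a → (con 1ℚ :+ a) :+ con (ℚ.- 1ℚ) := a) refl (y p))
    (ℚ.+-monoˡ-< (ℚ.- 1ℚ) (proj₁ (proj₂ (proj₂ realisation p q p<q)) Jpq)))

  y-far : ∀ {p q} → p Fin.< q → ¬ J p q → Gap 1ℚ (fromℚ (y q)) (fromℚ (y p))
  y-far {p} {q} p<q ¬Jpq = fromℚ-gap (proj₂ (proj₂ (proj₂ realisation p q p<q)) ¬Jpq)

  Sx : ShiComplement x
  Sx i j i<j with Fin.<-cmp (π⁻¹ i) (π⁻¹ j)
  ... | tri< p<q _ _ = inj₁ (gap⇒below {0ℚ} {x i} {x j} (y-increasing p<q)) ,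
                       inj₁ (gap⇒below {1ℚ} {x i} {x j} (gap-≤ -1≤0 (y-increasing p<q)))
  ... | tri≈ _ p≡q _ = ⊥-elim (Fin.<⇒≢ i<j (trans (sym (ππ⁻¹ i)) (trans (cong (lookup π) p≡q) (ππ⁻¹ j))))
  ... | tri> _ _ q<p with J? (π⁻¹ j) (π⁻¹ i)
  ...   | yes Jqp = inj₂ (ungap (y-increasing q<p)) , inj₁ (gap⇒below {1ℚ} {x i} {x j} (y-near q<p Jqp))
  ...   | no ¬Jqp = inj₂ (ungap (y-increasing q<p)) , inj₂ (ungap (y-far q<p ¬Jqp))

  transport : ∀ {c p q} → Gap c (fromℚ (y p)) (fromℚ (y q)) → Gap c (x (lookup π p)) (x (lookup π q))
  transport {c} {p} {q} = subst₂ (λ p′ q′ → Gap c (fromℚ (y p′)) (fromℚ (y q′)))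
    (sym (π⁻¹π p)) (sym (π⁻¹π q))

  code : Encodes (π , I) x
  code = encodes (λ p<q → transport (y-increasing p<q))
    (λ {p} {q} (p<q , _) g∈I → gap⇒below {1ℚ} {x (lookup π q)} {x (lookup π p)}
      (transport (y-near p<q (Any.map (λ { refl → ℕ.≤-refl , ℕ.≤-refl }) g∈I))))
    (λ inv@(p<q , _) g∉I → ungap (transport (y-far p<q λ Jpq → g∉I (J-ideal inv Jpq))))

-- Separation from the base region

separated₀⁻ : (R : Region n) → ∀ {i j} → SeparatingPair 0ℝ R (i , j) → i Fin.< j × Below 0ℝ i j (proj₁ R)
separated₀⁻ {n} (x , Sx) {i} {j} (i<j , inj₁ (_ , base⊆below)) =
  -- The base region lies above this hyperplane, and a point of it refutes the alternative that
  -- would put it below.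
  let b , base = basePoint n in
  ⊥-elim (above⇒¬below b 0ℚ i j (base-above b base i<j) (base⊆below {b} base))
separated₀⁻ (x , Sx) (i<j , inj₂ (R⊆below , _)) = i<j , R⊆below (sameComponent-refl ShiComplement x Sx)

separated₀⁺ : (R : Region n) → ∀ {i j} → i Fin.< j × Below 0ℝ i j (proj₁ R) → SeparatingPair 0ℝ R (i , j)
separated₀⁺ (x , Sx) {i} {j} (i<j , below) = i<j , inj₂
  ( (λ {y} same → proj₂ (proj₁ (sameComponent⇒agree {x = x} {y} same i j i<j)) below)
  , (λ {b} base → base-above b base i<j))

separated₁⁻ : (R : Region n) → ∀ {i j} → SeparatingPair 1ℝ R (i , j) → i Fin.< j × Above 1ℝ i j (proj₁ R)
separated₁⁻ {n} (x , Sx) {i} {j} (i<j , inj₂ (_ , base⊆above)) =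
  let b , base = basePoint n in
  ⊥-elim (above⇒¬below b 1ℚ i j (base⊆above {b} base) (base-below b base i<j))
separated₁⁻ (x , Sx) (i<j , inj₁ (R⊆above , _)) = i<j , R⊆above (sameComponent-refl ShiComplement x Sx)

separated₁⁺ : (R : Region n) → ∀ {i j} → i Fin.< j × Above 1ℝ i j (proj₁ R) → SeparatingPair 1ℝ R (i , j)
separated₁⁺ (x , Sx) {i} {j} (i<j , above) = i<j , inj₁
  ( (λ {y} same → proj₁ (proj₂ (sameComponent⇒agree {x = x} {y} same i j i<j)) above)
  , (λ {b} base → base-below b base i<j))

separated₀? : (R : Region n) → Decidable (SeparatingPair 0ℝ R)
separated₀? R@(x , Sx) (i , j) with i Fin.<? j
... | no i≮j = no λ sep → i≮j (proj₁ sep)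
... | yes i<j with proj₁ (Sx i j i<j)
...   | inj₁ below = yes (separated₀⁺ R (i<j , below))
...   | inj₂ above = no λ sep → above⇒¬below x 0ℚ i j above (proj₂ (separated₀⁻ R sep))

separated₁? : (R : Region n) → Decidable (SeparatingPair 1ℝ R)
separated₁? R@(x , Sx) (i , j) with i Fin.<? j
... | no i≮j = no λ sep → i≮j (proj₁ sep)
... | yes i<j with proj₂ (Sx i j i<j)
...   | inj₁ below = no λ sep → above⇒¬below x 1ℚ i j (proj₂ (separated₁⁻ R sep)) below
...   | inj₂ above = yes (separated₁⁺ R (i<j , above))

-- Counting the separating hyperplanes

cardinality : {P : Pred (Fin n × Fin n) ℓ} (P? : Decidable P) →
              HasCardinality P (length (filter P? (pairs n)))
cardinality {n} P? = filter P? (pairs n) , Unique.filter⁺ P? (pairs-unique n) ,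
  (λ g → mk⇔ (λ g∈ → proj₂ (∈-filter⁻ P? {xs = pairs n} g∈)) (∈-filter⁺ P? (∈-pairs g))) , refl

-- Separating pairs are recorded by coordinate indices, which are values of `π`, while inversions
-- and non-inversions are recorded by positions.
Match : (π : Vec (Fin n) n) → Fin n × Fin n → Fin n × Fin n → Set
Match π (i , j) (p , q) = lookup π p ≡ i × lookup π q ≡ j

match-clash : (π : Vec (Fin n) n) {gs : List (Fin n × Fin n)} → Unique gs →
              AllPairs (Clash (Match π)) gs
match-clash π = AllPairs.map λ { g≢h _ (refl , refl) (refl , refl) → g≢h refl }

match-clash′ : (π : Vec (Fin n) n) → Injective _≡_ _≡_ (lookup π) → {gs : List (Fin n × Fin n)} →
               Unique gs → AllPairs (Clash (λ g h → Match π h g)) gs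
match-clash′ π inj = AllPairs.map λ { g≢h _ (e₁ , e₂) (f₁ , f₂) →
  g≢h (cong₂ _,_ (inj (trans e₁ (sym f₁))) (inj (trans e₂ (sym f₂)))) }

uncovered : (c : Code n) → List (Fin n × Fin n)
uncovered (π , I) = filter (λ g → ¬? (g ∈? I)) (inversions π)

module _ {c : Code n} (R : Region n) (e : Encodes c (proj₁ R)) where

  private
    π = proj₁ c
    I = proj₂ c
    x = proj₁ R

    inj : Injective _≡_ _≡_ (lookup π)
    inj = increasing⇒injective {x = x} {π} (increasing e)

  count₀ : ∀ {m} → HasCardinality (SeparatingPair 0ℝ R) m → m ≡ length (nonInversions π)
  count₀ (gs , gs! , mem , refl) = length-≡ {R = Match π} to (match-clash π gs!)
    from (match-clash′ π inj (nonInversions-unique π))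
    where
    to : ∀ {g} → g ∈ gs → ∃[ h ] (h ∈ nonInversions π × Match π g h)
    to {i , j} g∈ with separated₀⁻ R (Equivalence.to (mem (i , j)) g∈)
    ... | i<j , below with position c inj i<j
    ...   | before p<q refl refl = _ , ∈-nonInversions⁺ π (p<q , i<j) , refl , refl
    ...   | near inv _ refl refl = ⊥-elim (above⇒¬below x 0ℚ _ _ (inversion-above e inv) below)
    ...   | far  inv _ refl refl = ⊥-elim (above⇒¬below x 0ℚ _ _ (inversion-above e inv) below)
    from : ∀ {h} → h ∈ nonInversions π → ∃[ g ] (g ∈ gs × Match π g h)
    from {p , q} h∈ = let p<q , i<j = ∈-nonInversions⁻ π h∈ in
      (lookup π p , lookup π q) ,
      Equivalence.from (mem _) (separated₀⁺ R (i<j , before-below₀ e p<q)) , refl , refl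

  -- Positions are listed in increasing order, so an inversion `(p , q)` carries its smaller value
  -- at `q`; hence the `swap` between it and the pair `i < j`.
  count₁ : ∀ {m} → HasCardinality (SeparatingPair 1ℝ R) m → m ≡ length (uncovered c)
  count₁ (gs , gs! , mem , refl) = length-≡ {R = λ g h → Match π (swap g) h} to
    (AllPairs.map (λ { g≢h _ (refl , refl) (refl , refl) → g≢h refl }) gs!)
    from
    (AllPairs.map (λ { g≢h _ (e₁ , e₂) (f₁ , f₂) →
        g≢h (cong₂ _,_ (inj (trans e₁ (sym f₁))) (inj (trans e₂ (sym f₂)))) })
      (Unique.filter⁺ (λ g → ¬? (g ∈? I)) (inversions-unique π)))
    where
    to : ∀ {g} → g ∈ gs → ∃[ h ] (h ∈ uncovered c × Match π (swap g) h)
    to {i , j} g∈ with separated₁⁻ R (Equivalence.to (mem (i , j)) g∈)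
    ... | i<j , above with position c inj i<j
    ...   | before p<q refl refl = ⊥-elim (above⇒¬below x 1ℚ _ _ above (before-below₁ e p<q))
    ...   | near inv g∈I refl refl = ⊥-elim (above⇒¬below x 1ℚ _ _ above (inside e inv g∈I))
    ...   | far  inv g∉I refl refl = _ , ∈-filter⁺ _ (∈-inversions⁺ π inv) g∉I , refl , refl
    from : ∀ {h} → h ∈ uncovered c → ∃[ g ] (g ∈ gs × Match π (swap g) h)
    from {p , q} h∈ =
      let h∈inv , h∉I = ∈-filter⁻ (λ g → ¬? (g ∈? I)) {xs = inversions π} h∈
          inv = ∈-inversions⁻ π h∈inv
      in (lookup π q , lookup π p) ,
         Equivalence.from (mem _) (separated₁⁺ R (proj₂ inv , outside e inv h∉I)) , refl , refl

-- Sizes of ideals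

length-ideal : (π : Vec (Fin n) n) {I : List (Fin n × Fin n)} → I ∈ ideals π →
               length I ℕ.+ length (uncovered (π , I)) ≡ length (inversions π)
length-ideal π {I} I∈ = trans
  (cong (ℕ._+ length (uncovered (π , I))) (unique-length-≡ (∈-subsets⇒unique (inversions-unique π) I∈subsets)
    (Unique.filter⁺ (_∈? I) (inversions-unique π))
    (λ g∈I → ∈-filter⁺ (_∈? I) (∈-subsets⇒⊆ (inversions π) I∈subsets g∈I) g∈I)
    (λ g∈ → proj₂ (∈-filter⁻ (_∈? I) {xs = inversions π} g∈))))
  (length-filter-¬ (_∈? I) (inversions π))
  where
  I∈subsets = proj₁ (∈-filter⁻ (isIdeal? π) {xs = subsets (inversions π)} I∈)

-- If `k` non-inversions, `m` elements of the ideal and `b` remaining inversions make up all pairs,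
-- the prescribed size misses `m` by `b - ℓ`. So the size is right exactly when `ℓ = b`, and
-- negative sizes need no separate case.
size-difference : ∀ {c} k ℓ m b → k ℕ.+ (m ℕ.+ b) ≡ c →
                  (+ c ℤ.- + k ℤ.- + ℓ) ℤ.- + m ≡ + b ℤ.- + ℓ
size-difference k ℓ m b refl =
  ℤ-solve 4 (λ k ℓ m b → ((k ⊕ (m ⊕ b)) ⊖ k ⊖ ℓ) ⊖ m ⊜ b ⊖ ℓ) refl (+ k) (+ ℓ) (+ m) (+ b)
  where open ℤSolver.+-*-Solver
          renaming (solve to ℤ-solve; _:+_ to _⊕_; _:-_ to _⊖_; _:=_ to _⊜_)

size⇒≡ : ∀ {c} k ℓ m b → k ℕ.+ (m ℕ.+ b) ≡ c → + m ≡ + c ℤ.- + k ℤ.- + ℓ → ℓ ≡ b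
size⇒≡ k ℓ m b eq m≡ = sym (ℤ.+-injective (ℤ.i-j≡0⇒i≡j (+ b) (+ ℓ)
  (trans (sym (size-difference k ℓ m b eq)) (ℤ.i≡j⇒i-j≡0 (sym m≡)))))

≡⇒size : ∀ {c} k m b → k ℕ.+ (m ℕ.+ b) ≡ c → + m ≡ + c ℤ.- + k ℤ.- + b
≡⇒size k m b eq = sym (ℤ.i-j≡0⇒i≡j _ (+ m)
  (trans (size-difference k b m b eq) (ℤ.+-inverseʳ (+ b))))

-- The list of all codes

codes : List (Vec (Fin n) n) → (Vec (Fin n) n → List (List (Fin n × Fin n))) → List (Code n)
codes πs Is = concat (map (λ π → map (π ,_) (Is π)) πs)

module _ (Is : Vec (Fin n) n → List (List (Fin n × Fin n))) where

  length-codes : ∀ πs → length (codes πs Is) ≡ sum (map (λ π → length (Is π)) πs)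
  length-codes []       = refl
  length-codes (π ∷ πs) = trans (List.length-++ (map (π ,_) (Is π)))
    (cong₂ ℕ._+_ (List.length-map (π ,_) (Is π)) (length-codes πs))

  ∈-codes⁺ : ∀ {πs π I} → π ∈ πs → I ∈ Is π → (π , I) ∈ codes πs Is
  ∈-codes⁺ π∈ I∈ = ∈-concat⁺′ (∈-map⁺ _ I∈) (∈-map⁺ _ π∈)

  ∈-codes⁻ : ∀ πs {c} → c ∈ codes πs Is → proj₁ c ∈ πs × proj₂ c ∈ Is (proj₁ c)
  ∈-codes⁻ πs c∈ with ∈-concat⁻′ (map (λ π → map (π ,_) (Is π)) πs) c∈
  ... | cs , c∈cs , cs∈ with ∈-map⁻ _ cs∈
  ...   | π , π∈ , refl with ∈-map⁻ (π ,_) c∈cs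
  ...     | I , I∈ , refl = π∈ , I∈

  codes-clash : ∀ {πs} → Unique πs → (∀ π → AllPairs (DifferWithin (inversions π)) (Is π)) →
                AllPairs (Clash (λ c (R : Region n) → Encodes c (proj₁ R))) (codes πs Is)
  codes-clash {πs} πs! differ = AllPairs.concat⁺
    (All.map⁺ (All.universal (λ π → AllPairs.map⁺ (AllPairs.map
      (λ d R e f → proj₂ (encodes-clash e f) d) (differ π))) πs))
    (AllPairs.map⁺ (AllPairs.map (λ {π} {ρ} π≢ρ → All.tabulate λ c∈ → All.tabulate λ d∈ →
      apart π≢ρ (∈-map⁻ _ c∈) (∈-map⁻ _ d∈)) πs!))
    where
    apart : ∀ {π ρ c d} → π ≢ ρ → ∃[ I ] (I ∈ Is π × c ≡ (π , I)) → ∃[ J ] (J ∈ Is ρ × d ≡ (ρ , J)) →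
            (R : Region n) → Encodes c (proj₁ R) → ¬ Encodes d (proj₁ R)
    apart π≢ρ (_ , _ , refl) (_ , _ , refl) R e f = π≢ρ (proj₁ (encodes-clash e f))

ideals-differ : (π : Vec (Fin n) n) → AllPairs (DifferWithin (inversions π)) (ideals π)
ideals-differ π = AllPairs.filter⁺ (isIdeal? π) (subsets-differ (inversions-unique π))

regions-clash : {rs : List (Region n)} → SetoidUnique.Unique (Regions n) rs →
                AllPairs (Clash (λ (R : Region n) c → Encodes c (proj₁ R))) rs
regions-clash = AllPairs.map λ {R} {R′} R≉R′ c e f →
  R≉R′ (agree⇒sameComponent {x = proj₁ R} {proj₁ R′} (proj₂ R) (encodes⇒agree e f))

-- An enumeration of the regions

Represented : Code n → Set
Represented {n} c = Σ[ R ∈ Region n ] Encodes c (proj₁ R)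

representatives : {cs : List (Code n)} → All Represented cs → List (Region n)
representatives = All.reduce proj₁

representatives-all : {cs : List (Code n)} (cs↦ : All Represented cs) →
  {P : Pred (Code n) 0ℓ} {Q : Pred (Region n) ℓ} → All P cs →
  (∀ {c R} → Encodes c (proj₁ R) → P c → Q R) → All Q (representatives cs↦)
representatives-all []              []         f = []
representatives-all ((_ , e) ∷ cs↦) (pc ∷ pcs) f = f e pc ∷ representatives-all cs↦ pcs f

representatives-any : {cs : List (Code n)} (cs↦ : All Represented cs) →
  ∀ {c} → c ∈ cs → Any (λ R → Encodes c (proj₁ R)) (representatives cs↦)
representatives-any ((_ , e) ∷ cs↦) (here refl) = here e
representatives-any ((_ , e) ∷ cs↦) (there c∈)  = there (representatives-any cs↦ c∈)

-- If two representatives shared a component, the code of one would be transported to the other,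
-- which would then satisfy two clashing codes.
representatives-unique : {cs : List (Code n)} (cs↦ : All Represented cs) →
  AllPairs (Clash (λ c (R : Region n) → Encodes c (proj₁ R))) cs →
  SetoidUnique.Unique (Regions n) (representatives cs↦)
representatives-unique []              []               = []
representatives-unique ((R , e) ∷ cs↦) (clash ∷ clashes) =
  representatives-all cs↦ clash (λ {c} {R′} e′ c-clash R≈R′ → c-clash R′
    (encodes-resp (sameComponent⇒agree {x = proj₁ R} {proj₁ R′} R≈R′) e) e′)
  ∷ representatives-unique cs↦ clashes

shiRegions : ∀ n → ShiRegions n
shiRegions n = record
  { regions  = representatives decoded
  ; unique   = representatives-unique decoded (codes-clash ideals (permutations-unique n) ideals-differ)
  ; complete = λ R@(x , Sx) →
      let π , I , π∈ , I∈ , e = encode x Sx in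
      Any.map (λ {R′} e′ → agree⇒sameComponent {x = x} {proj₁ R′} Sx (encodes⇒agree e e′))
        (representatives-any decoded (∈-codes⁺ ideals π∈ I∈))
  ; a = λ R → length (filter (separated₀? R) (pairs n))
  ; b = λ R → length (filter (separated₁? R) (pairs n))
  ; a-counts = λ R → cardinality (separated₀? R)
  ; b-counts = λ R → cardinality (separated₁? R)
  }
  where
  decoded : All Represented (codes (permutations n) ideals)
  decoded = All.tabulate λ c∈ →
    let π∈ , I∈ = ∈-codes⁻ ideals (permutations n) c∈ in decode π∈ I∈

-- Comparing the coefficients

∑-coefficient : (a b : A → ℕ) (k ℓ : ℕ) (xs : List A) →
  ∑ (map (λ x → q^ a x t^ b x) xs) k ℓ ≡
  length (filter (λ x → (k ℕ.≟ a x) ×-dec (ℓ ℕ.≟ b x)) xs)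
∑-coefficient a b k ℓ []       = refl
∑-coefficient a b k ℓ (x ∷ xs) with does ((k ℕ.≟ a x) ×-dec (ℓ ℕ.≟ b x))
... | true  = cong suc (∑-coefficient a b k ℓ xs)
... | false = ∑-coefficient a b k ℓ xs

module _ (𝓡 : ShiRegions n) (k ℓ : ℕ) where
  open ShiRegions 𝓡

  private
    Selected : Region n → Set
    Selected R = k ≡ a R × ℓ ≡ b R

    selected? : Decidable Selected
    selected? R = (k ℕ.≟ a R) ×-dec (ℓ ℕ.≟ b R)

    HasSize : List (Fin n × Fin n) → Set
    HasSize I = + length I ≡ + (n choose 2) ℤ.- + k ℤ.- + ℓ

    hasSize? : Decidable HasSize
    hasSize? I = + length I ℤ.≟ (+ (n choose 2) ℤ.- + k ℤ.- + ℓ)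

    sizedIdeals : Vec (Fin n) n → List (List (Fin n × Fin n))
    sizedIdeals π = filter hasSize? (ideals π)

    nonInversions≟k : Decidable (λ (π : Vec (Fin n) n) → length (nonInversions π) ≡ k)
    nonInversions≟k π = length (nonInversions π) ℕ.≟ k

  statistics : ∀ {π I} (R : Region n) → I ∈ ideals π → Encodes (π , I) (proj₁ R) →
    a R ≡ length (nonInversions π) × b R ≡ length (uncovered (π , I)) ×
    length (nonInversions π) ℕ.+ (length I ℕ.+ length (uncovered (π , I))) ≡ n choose 2
  statistics {π} {I} R I∈ e =
    count₀ R e (a-counts R) , count₁ R e (b-counts R) ,
    trans (cong (length (nonInversions π) ℕ.+_) (length-ideal π I∈))
      (length-inversions π (increasing⇒injective {x = proj₁ R} {π} (increasing e)))

  Dist≡length-codes : Dist 𝓡 k ℓ ≡ length (codes Π[ k ] sizedIdeals)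
  Dist≡length-codes = trans (∑-coefficient a b k ℓ regions) (length-≡
    {R = λ R c → Encodes c (proj₁ R)}
    to (AllPairs.filter⁺ selected? (regions-clash unique))
    from (codes-clash sizedIdeals (Unique.filter⁺ nonInversions≟k (permutations-unique n))
      (λ π → AllPairs.filter⁺ hasSize? (ideals-differ π))))
    where
    to : ∀ {R} → R ∈ filter selected? regions →
         ∃[ c ] (c ∈ codes Π[ k ] sizedIdeals × Encodes c (proj₁ R))
    to {R} R∈ =
      let _ , k≡a , ℓ≡b = ∈-filter⁻ selected? {xs = regions} R∈
          π , I , π∈ , I∈ , e = encode (proj₁ R) (proj₂ R)
          a≡ , b≡ , total = statistics R I∈ e
          k≡ = trans k≡a a≡
          ℓ≡ = trans ℓ≡b b≡
      in (π , I) , ∈-codes⁺ sizedIdeals (∈-filter⁺ nonInversions≟k π∈ (sym k≡))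
           (∈-filter⁺ hasSize? I∈ (subst₂ (λ k ℓ → + length I ≡ + (n choose 2) ℤ.- + k ℤ.- + ℓ)
             (sym k≡) (sym ℓ≡) (≡⇒size (length (nonInversions π)) (length I) (length (uncovered (π , I))) total))) , e

    from : ∀ {c} → c ∈ codes Π[ k ] sizedIdeals →
           ∃[ R ] (R ∈ filter selected? regions × Encodes c (proj₁ R))
    from {π , I} c∈ =
      let π∈Π , I∈sized = ∈-codes⁻ sizedIdeals Π[ k ] c∈
          π∈ , k≡ = ∈-filter⁻ nonInversions≟k {xs = permutations n} π∈Π
          I∈ , size = ∈-filter⁻ hasSize? {xs = ideals π} I∈sized
          R₀ , e₀ = decode π∈ I∈
          -- The decoded region occurs in `𝓡` possibly under another representative; the code is
          -- carried over to that one within the component.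
          R , R∈ , R₀≈R = find (complete R₀)
          e = encodes-resp (sameComponent⇒agree {x = proj₁ R₀} {proj₁ R} R₀≈R) e₀
          a≡ , b≡ , total = statistics R I∈ e
      in R , ∈-filter⁺ selected? R∈
           ( sym (trans a≡ k≡)
           , trans (size⇒≡ k ℓ (length I) _ (subst (λ k → k ℕ.+ _ ≡ _) k≡ total) size) (sym b≡)) , e

  Dist≡∑IP : Dist 𝓡 k ℓ ≡ sum (map (λ π → IP π k ℓ) (Π[ k ] {n}))
  Dist≡∑IP = trans Dist≡length-codes (length-codes sizedIdeals Π[ k ])

theorem1 : (n : ℕ) → 2 ≤ n → (k ℓ : ℕ) →
    ShiRegions n ×
    ((𝓡 : ShiRegions n) → Dist 𝓡 k ℓ ≡ sum (map (λ π → IP π k ℓ) (Π[ k ] {n})))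
theorem1 n _ k ℓ = shiRegions n , λ 𝓡 → Dist≡∑IP 𝓡 k ℓ
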